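{- Let $n\ge1$ and let $\mathcal{L}$ be the vertex labeling of the linear representation of some linked cycle on $[n]$, and let $LC_n(\mathcal{L})$ be the set of linked cycles on $[n]$ whose linear representation has vertex labeling $\mathcal{L}$. Then $$\sum_{\hat\pi\in LC_n(\mathcal{L})}x^{cr(\hat\pi)}y^{ne(\hat\pi)}=\sum_{\hat\pi\in LC_n(\mathcal{L})}x^{ne(\hat\pi)}y^{cr(\hat\pi)},$$ i.e. $cr$ and $ne$ have a symmetric joint distribution over $LC_n(\mathcal{L})$.
   Context: Two finite sets of integers $E,F$ are nearly disjoint if for every $i\in E\cap F$ either ($i=\min(E)$, $|E|>1$, $i\ne\min(F)$) or ($i=\min(F)$, $|F|>1$, $i\ne\min(E)$). A linked partition of $[n]$ is a set of nonempty subsets (blocks) of $[n]$ with union $[n]$, any two distinct blocks nearly disjoint; each element lies in one or two blocks (singly/doubly covered). A linked cycle on $[n]$ is a linked partition of $[n]$ with a cyclic arrangement of each block; a cycle is written $(i_1i_2\dots i_t)$ with $i_1$ its minimum. Linear representation of a linked cycle $\hat\pi$: for each $i\in[n]$ create vertices: if $i$ is singly covered and the minimum of its cycle, of size $k+1$, create $i^{(1)},\dots,i^{(k)}$ if $k\ge1$, and a single isolated vertex $i^{(1)}$ if $k=0$; if $i$ is singly covered and not the minimum of its cycle, create $i^{(0)}$; if $i$ is doubly covered and the minimum of a cycle of size $k+1$, create $i^{(0)},i^{(1)},\dots,i^{(k)}$. Vertices lie on a line ordered by $i$, then by superscript. For each cycle $(i_1\dots i_t)$, $t\ge2$, draw arcs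 $(i_1^{(j)},i_{t+1-j}^{(0)})$, $j=1,\dots,t-1$. The vertex labeling is the left-to-right sequence of vertex labels. A $k$-crossing is a set of $k$ arcs $(x_1,y_1),\dots,(x_k,y_k)$ whose endpoints appear in the order $x_1,\dots,x_k,y_1,\dots,y_k$; a $k$-nesting is one whose endpoints appear in the order $x_1,\dots,x_k,y_k,\dots,y_1$. $cr(\hat\pi)$ (resp. $ne(\hat\pi)$) is the largest $k$ such that $\hat\pi$ has a $k$-crossing (resp. $k$-nesting). -}

module Defs where

open import Algebra.Bundles using (CommutativeSemiring)
open import Data.Fin.Base as Fin using (Fin)
import Data.Fin.Properties as Fin
open import Data.List.Base
open import Data.List.Extrema.Nat using (max; xs≤max; argmax-sel)
open import Data.List.Membership.Propositional using (_∈_)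
open import Data.List.Membership.Propositional.Properties
open import Data.List.NonEmpty.Base as List⁺ using (List⁺; toList)
open import Data.List.Properties using (length-map; length-++; length-tabulate; ≡-dec)
open import Data.List.Relation.Unary.All as All using (All; []; _∷_)
import Data.List.Relation.Unary.All.Properties as All
open import Data.List.Relation.Unary.AllPairs as AllPairs using (AllPairs; []; _∷_)
import Data.List.Relation.Unary.AllPairs.Properties as AllPairs
open import Data.List.Relation.Unary.Any as Any using (Any; here; there)
open import Data.List.Relation.Unary.Unique.Propositional using (Unique)
import Data.List.Relation.Unary.Unique.Propositional.Properties as Unique
import Data.List.Relation.Unary.Unique.DecPropositional as DecUnique
open import Data.Nat.Base using (ℕ; zero; suc; _≤_; _<_; _>_; z≤n; s≤s)
import Data.Nat.Properties as ℕ
open import Data.Product.Base using (∃-syntax; _×_; _,_; proj₁; proj₂; uncurry)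
import Data.Product.Properties as Product
open import Data.Product.Relation.Binary.Lex.Strict using (×-Lex; ×-decidable)
open import Data.Sum.Base using (_⊎_; inj₁; inj₂)
open import Function.Base using (_∘_; id)
open import Level using (0ℓ)
open import Relation.Binary.Core using (Rel)
open import Relation.Binary.Definitions using (DecidableEquality)
import Relation.Binary.Definitions as B
open import Relation.Binary.PropositionalEquality
  using (_≡_; _≢_; refl; sym; cong; subst)
open import Relation.Nullary using (Dec; contradiction)
open import Relation.Nullary.Decidable using (map′; ¬?; _×-dec_; _⊎-dec_; _→-dec_)
open import Relation.Unary using (Pred; Decidable)

private
  variable
    n : ℕ
    A : Set

------------------------------------------------------------------------
-- Linked cycles

-- The ground set [n] = {1,…,n} is represented by Fin n, with its order.

-- The cycle (i₁ i₂ … iₜ) is the non-empty list of i₁, i₂, …, iₜ.  As i₁ is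
-- required to be the minimum, each cyclic arrangement of each block has
-- exactly one such list.

Cycle : ℕ → Set
Cycle n = List⁺ (Fin n)

minimum : Cycle n → Fin n
minimum = List⁺.head

infix 4 _∈ᶜ_

_∈ᶜ_ : Fin n → Cycle n → Set
i ∈ᶜ c = i ∈ toList c

record IsCycle (c : Cycle n) : Set where
  constructor mkIsCycle
  field
    minimal  : All (minimum c Fin.<_) (List⁺.tail c)
    distinct : Unique (toList c)

NearlyDisjoint : Rel (Cycle n) 0ℓ
NearlyDisjoint E F = ∀ i → i ∈ᶜ E → i ∈ᶜ F →
  (i ≡ minimum E × List⁺.length E > 1 × i ≢ minimum F) ⊎
  (i ≡ minimum F × List⁺.length F > 1 × i ≢ minimum E)

-- Nearly disjoint blocks have different minima.  Hence the *set* of cycles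
-- of a linked cycle is exactly a list of cycles sorted by strictly
-- increasing minima, and propositional equality of such lists is equality
-- of linked cycles.

record IsLinkedCycle (π : List (Cycle n)) : Set where
  constructor mkIsLinkedCycle
  field
    cycles         : All IsCycle π
    sorted         : AllPairs (λ c d → minimum c Fin.< minimum d) π
    nearlyDisjoint : AllPairs NearlyDisjoint π
    covering       : ∀ i → Any (i ∈ᶜ_) π

------------------------------------------------------------------------
-- Linear representation

-- (i , j) is the vertex i⁽ʲ⁾.

Vertex : ℕ → Set
Vertex n = Fin n × ℕ

infix 4 _<ᵥ_

_<ᵥ_ : Rel (Vertex n) 0ℓ
_<ᵥ_ = ×-Lex _≡_ Fin._<_ _<_

_∈ᶜ?_ : (i : Fin n) (c : Cycle n) → Dec (i ∈ᶜ c)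
i ∈ᶜ? c = Any.any? (i Fin.≟_) (toList c)

coverage : List (Cycle n) → Fin n → ℕ
coverage π i = length (filter (i ∈ᶜ?_) π)

-- The numbers k such that i is the minimum of a cycle of size k + 1; in a
-- linked cycle there is at most one.

openings : List (Cycle n) → Fin n → List ℕ
openings π i = map (length ∘ List⁺.tail) (filter (λ c → i Fin.≟ minimum c) π)

-- The first argument is the coverage of i and the second is its openings.
-- In a linked cycle every i falls under one of the first four clauses.

superscripts : ℕ → List ℕ → List ℕ
superscripts 1 (0 ∷ _) = 1 ∷ []
superscripts 1 (k ∷ _) = map suc (upTo k)
superscripts 1 []      = 0 ∷ []
superscripts 2 (k ∷ _) = upTo (suc k)
superscripts _ _       = []

labelling : List (Cycle n) → List (Vertex n)
labelling {n} π =
  concatMap (λ i → map (i ,_) (superscripts (coverage π i) (openings π i))) (allFin n)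

Arc : ℕ → Set
Arc n = Vertex n × Vertex n

-- With cycle = (i₁ i₂ … iₜ), the reversed tail is iₜ, …, i₂, whose j-th
-- entry is iₜ₊₁₋ⱼ.

cycleArcs : Cycle n → List (Arc n)
cycleArcs (i₁ List⁺.∷ is) =
  zipWith (λ j i → (i₁ , j) , (i , 0)) (map suc (upTo (length is))) (reverse is)

arcs : List (Cycle n) → List (Arc n)
arcs = concatMap cycleArcs

------------------------------------------------------------------------
-- Crossings and nestings

InOrder : List (Vertex n) → Set
InOrder = AllPairs _<ᵥ_

-- The set {(x₁,y₁),…,(xₖ,yₖ)} is given as the list of its arcs by
-- increasing x, so that k is the length of the list.

IsCrossing : List (Cycle n) → List (Arc n) → Set
IsCrossing π αs = All (_∈ arcs π) αs × InOrder (map proj₁ αs ++ map proj₂ αs)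

IsNesting : List (Cycle n) → List (Arc n) → Set
IsNesting π αs = All (_∈ arcs π) αs × InOrder (map proj₁ αs ++ reverse (map proj₂ αs))

_≟ᵥ_ : DecidableEquality (Vertex n)
_≟ᵥ_ = Product.≡-dec Fin._≟_ ℕ._≟_

inOrder? : Decidable (InOrder {n})
inOrder? = AllPairs.allPairs? (×-decidable Fin._≟_ Fin._<?_ ℕ._<?_)

_∈arcs?_ : (α : Arc n) (π : List (Cycle n)) → Dec (α ∈ arcs π)
α ∈arcs? π = Any.any? (Product.≡-dec _≟ᵥ_ _≟ᵥ_ α) (arcs π)

isCrossing? : (π : List (Cycle n)) → Decidable (IsCrossing π)
isCrossing? π αs = All.all? (_∈arcs? π) αs ×-dec inOrder? (map proj₁ αs ++ map proj₂ αs)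

isNesting? : (π : List (Cycle n)) → Decidable (IsNesting π)
isNesting? π αs = All.all? (_∈arcs? π) αs ×-dec inOrder? (map proj₁ αs ++ reverse (map proj₂ αs))

-- All lists of length at most m with entries in xs.

lists : ℕ → List A → List (List A)
lists zero    xs = [] ∷ []
lists (suc m) xs = [] ∷ cartesianProductWith _∷_ xs (lists m xs)

-- The arcs of a crossing or nesting are distinct, so its size is at most
-- the number of arcs; see cr-upper and ne-upper below.

candidates : List (Cycle n) → List (List (Arc n))
candidates π = lists (length (arcs π)) (arcs π)

cr : List (Cycle n) → ℕ
cr π = max 0 (map length (filter (isCrossing? π) (candidates π)))

ne : List (Cycle n) → ℕ
ne π = max 0 (map length (filter (isNesting? π) (candidates π)))

------------------------------------------------------------------------
-- The set LCₙ(𝓛)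

isCycle? : Decidable (IsCycle {n})
isCycle? c = map′ (uncurry mkIsCycle) (λ p → IsCycle.minimal p , IsCycle.distinct p)
  (All.all? (minimum c Fin.<?_) (List⁺.tail c) ×-dec DecUnique.unique? Fin._≟_ (toList c))

nearlyDisjoint? : B.Decidable (NearlyDisjoint {n})
nearlyDisjoint? E F = Fin.all? λ i → (i ∈ᶜ? E) →-dec ((i ∈ᶜ? F) →-dec
  ((i Fin.≟ minimum E ×-dec 1 ℕ.<? List⁺.length E ×-dec ¬? (i Fin.≟ minimum F)) ⊎-dec
   (i Fin.≟ minimum F ×-dec 1 ℕ.<? List⁺.length F ×-dec ¬? (i Fin.≟ minimum E))))

isLinkedCycle? : Decidable (IsLinkedCycle {n})
isLinkedCycle? π = map′
  (λ (a , b , c , d) → mkIsLinkedCycle a b c d)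
  (λ p → let open IsLinkedCycle p in cycles , sorted , nearlyDisjoint , covering)
  (All.all? isCycle? π
    ×-dec AllPairs.allPairs? (λ c d → minimum c Fin.<? minimum d) π
    ×-dec AllPairs.allPairs? nearlyDisjoint? π
    ×-dec Fin.all? (λ i → Any.any? (i ∈ᶜ?_) π))

HasLabelling : List (Vertex n) → Pred (List (Cycle n)) 0ℓ
HasLabelling 𝓛 π = IsLinkedCycle π × labelling π ≡ 𝓛

hasLabelling? : (𝓛 : List (Vertex n)) → Decidable (HasLabelling 𝓛)
hasLabelling? 𝓛 π = isLinkedCycle? π ×-dec ≡-dec _≟ᵥ_ (labelling π) 𝓛

-- LC n 𝓛 lists every linked cycle with labelling 𝓛 exactly once; see ∈-LC⁺,
-- ∈-LC⁻ and LC-unique below.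

LC : ∀ n → List (Vertex n) → List (List (Cycle n))
LC n 𝓛 = filter (hasLabelling? 𝓛)
  (lists n (cartesianProductWith List⁺._∷_ (allFin n) (lists n (allFin n))))

module Summation {a ℓ} (R : CommutativeSemiring a ℓ) where
  open CommutativeSemiring R public using (Carrier; _≈_; _+_; _*_; 0#)
  open import Algebra.Properties.Semiring.Exp (CommutativeSemiring.semiring R) public using (_^_)

  ∑ : List A → (A → Carrier) → Carrier
  ∑ xs f = foldr (λ x s → f x + s) 0# xs

------------------------------------------------------------------------
-- Correctness of lists

∈-lists⁺ : ∀ {m} {xs ys : List A} → length ys ≤ m → All (_∈ xs) ys → ys ∈ lists m xs
∈-lists⁺ {m = zero}  z≤n     []         = here refl
∈-lists⁺ {m = suc m} z≤n     []         = here refl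
∈-lists⁺ {m = suc m} (s≤s l) (y∈ ∷ ys∈) =
  there (∈-cartesianProductWith⁺ _∷_ y∈ (∈-lists⁺ l ys∈))

private
  ∷-injective : ∀ {x y : A} {xs ys} → x List.∷ xs ≡ y ∷ ys → x ≡ y × xs ≡ ys
  ∷-injective refl = refl , refl

  ∷⁺-injective : ∀ {x y : A} {xs ys} → x List⁺.∷ xs ≡ y List⁺.∷ ys → x ≡ y × xs ≡ ys
  ∷⁺-injective refl = refl , refl

lists-unique : ∀ m {xs : List A} → Unique xs → Unique (lists m xs)
lists-unique zero         xs! = [] ∷ []
lists-unique (suc m) {xs} xs! =
  All.tabulate (λ {ys} ys∈ []≡ys → nonempty ys∈ []≡ys)
  ∷ Unique.cartesianProductWith⁺ _∷_ ∷-injective xs! (lists-unique m xs!)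
  where
  nonempty : ∀ {ys} → ys ∈ cartesianProductWith _∷_ xs (lists m xs) → [] ≢ ys
  nonempty ys∈ refl with ∈-cartesianProductWith⁻ _∷_ xs (lists m xs) ys∈
  ... | _ , _ , _ , _ , ()

pigeonhole : ∀ {xs ys : List A} → Unique xs → All (_∈ ys) xs → length xs ≤ length ys
pigeonhole {xs = []}     []          []         = z≤n
pigeonhole {xs = x ∷ xs} (x∉ ∷ xs!) (x∈ ∷ xs∈) with ∈-∃++ x∈
... | as , bs , refl = subst (suc (length xs) ≤_) (sym eq)
  (s≤s (pigeonhole xs! (All.zipWith (λ (x≢ , y∈) → drop-x x≢ y∈) (x∉ , xs∈))))
  where
  eq : length (as ++ x ∷ bs) ≡ suc (length (as ++ bs))
  eq rewrite length-++ as {x ∷ bs} | length-++ as {bs} = ℕ.+-suc _ _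

  drop-x : ∀ {y} → x ≢ y → y ∈ as ++ x ∷ bs → y ∈ as ++ bs
  drop-x x≢ y∈ with ∈-++⁻ as y∈
  ... | inj₁ y∈as         = ∈-++⁺ˡ y∈as
  ... | inj₂ (here y≡x)   = contradiction (sym y≡x) x≢
  ... | inj₂ (there y∈bs) = ∈-++⁺ʳ as y∈bs

------------------------------------------------------------------------
-- cr and ne are the largest sizes of a crossing and of a nesting

private
  <ᵥ⇒≢ : ∀ {u v : Vertex n} → u <ᵥ v → u ≢ v
  <ᵥ⇒≢ (inj₁ i<i)       refl = Fin.<-irrefl refl i<i
  <ᵥ⇒≢ (inj₂ (_ , j<j)) refl = ℕ.<-irrefl refl j<j

  inOrder⇒≤ : ∀ (π : List (Cycle n)) αs {vs} → All (_∈ arcs π) αs →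
              InOrder (map proj₁ αs ++ vs) → length αs ≤ length (arcs π)
  inOrder⇒≤ π αs αs∈ ord =
    pigeonhole (AllPairs.map (λ x<y α≡β → <ᵥ⇒≢ x<y (cong proj₁ α≡β)) (xs-ord αs ord)) αs∈
    where
    xs-ord : ∀ αs {vs} → InOrder (map proj₁ αs ++ vs) →
             AllPairs (λ α β → proj₁ α <ᵥ proj₁ β) αs
    xs-ord []       _       = []
    xs-ord (α ∷ αs) (p ∷ q) = All.map⁻ (All.++⁻ˡ (map proj₁ αs) p) ∷ xs-ord αs q

  module Largest {P : Pred (List A) 0ℓ} (P? : Decidable P) (P[] : P [])
                 (xss : List (List A)) where

    ≤-largest : ∀ {xs} → xs ∈ xss → P xs → length xs ≤ max 0 (map length (filter P? xss))
    ≤-largest xs∈ pxs =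
      All.lookup (xs≤max 0 _) (∈-map⁺ length (∈-filter⁺ P? xs∈ pxs))

    largest-attained : ∃[ xs ] P xs × length xs ≡ max 0 (map length (filter P? xss))
    largest-attained with argmax-sel id 0 (map length (filter P? xss))
    ... | inj₁ ≡0 = [] , P[] , sym ≡0
    ... | inj₂ m∈ with ∈-map⁻ length m∈
    ...   | xs , xs∈ , eq = xs , proj₂ (∈-filter⁻ P? {xs = xss} xs∈) , sym eq

module _ (π : List (Cycle n)) where

  cr-upper : ∀ {αs} → IsCrossing π αs → length αs ≤ cr π
  cr-upper {αs} p@(αs∈ , ord) = Largest.≤-largest (isCrossing? π) ([] , []) (candidates π)
    (∈-lists⁺ (inOrder⇒≤ π αs αs∈ ord) αs∈) p

  cr-attained : ∃[ αs ] IsCrossing π αs × length αs ≡ cr π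
  cr-attained = Largest.largest-attained (isCrossing? π) ([] , []) (candidates π)

  ne-upper : ∀ {αs} → IsNesting π αs → length αs ≤ ne π
  ne-upper {αs} p@(αs∈ , ord) = Largest.≤-largest (isNesting? π) ([] , []) (candidates π)
    (∈-lists⁺ (inOrder⇒≤ π αs αs∈ ord) αs∈) p

  ne-attained : ∃[ αs ] IsNesting π αs × length αs ≡ ne π
  ne-attained = Largest.largest-attained (isNesting? π) ([] , []) (candidates π)

------------------------------------------------------------------------
-- Correctness of LC

private
  unique⇒≤ : {is : List (Fin n)} → Unique is → length is ≤ n
  unique⇒≤ {n} {is} is! = subst (length is ≤_) (length-tabulate {n = n} id)
    (pigeonhole is! (All.tabulate (λ {i} _ → ∈-allFin i)))

∈-LC⁺ : ∀ {𝓛} {π : List (Cycle n)} → HasLabelling 𝓛 π → π ∈ LC n 𝓛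
∈-LC⁺ {n} {𝓛} {π} p@(lc , _) =
  ∈-filter⁺ (hasLabelling? 𝓛) (∈-lists⁺ |π|≤n (All.map cycle∈ cycles)) p
  where
  open IsLinkedCycle lc

  |π|≤n : length π ≤ n
  |π|≤n = subst (_≤ n) (length-map minimum π)
    (unique⇒≤ (AllPairs.map⁺ (AllPairs.map Fin.<⇒≢ sorted)))

  cycle∈ : ∀ {c} → IsCycle c → c ∈ cartesianProductWith List⁺._∷_ (allFin n) (lists n (allFin n))
  cycle∈ (mkIsCycle _ (_ ∷ is!)) = ∈-cartesianProductWith⁺ List⁺._∷_ (∈-allFin _)
    (∈-lists⁺ (unique⇒≤ is!) (All.tabulate (λ {i} _ → ∈-allFin i)))

∈-LC⁻ : ∀ {𝓛} {π : List (Cycle n)} → π ∈ LC n 𝓛 → HasLabelling 𝓛 π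
∈-LC⁻ {n} {𝓛} π∈ = proj₂ (∈-filter⁻ (hasLabelling? 𝓛) {xs = lists n _} π∈)

LC-unique : ∀ (𝓛 : List (Vertex n)) → Unique (LC n 𝓛)
LC-unique {n} 𝓛 = Unique.filter⁺ (hasLabelling? 𝓛) (lists-unique n
  (Unique.cartesianProductWith⁺ List⁺._∷_ ∷⁺-injective (Unique.allFin⁺ n)
    (lists-unique n (Unique.allFin⁺ n))))

{-# OPTIONS --safe #-}

-- Disregarding isolated vertices, a linear representation is a matching of
-- openers to closers, and cr and ne are its largest crossing and nesting.  Sweep
-- the vertices from right to left: at a closer, insert the opener of its arc
-- into a tableau by row insertion; at an opener, which is then the largest
-- entry, delete it.  The reading word of the tableau stays Knuth equivalent to
-- the word of openers of the arcs that are currently open, ordered by their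
-- closers.  Increasing and decreasing subsequences of this word are crossings
-- and nestings, and their largest lengths are invariant under Knuth equivalence,
-- so they are the numbers of rows and columns of the tableau.  As row insertion
-- can be undone from the cell that it adds, the matching is determined by the
-- sequence of shapes, and transposing all the shapes gives another matching with
-- the same openers and closers in which the two statistics are exchanged.
--
-- The vertex of a singleton cycle is labelled like the opener of a cycle of size
-- two, so 𝓛 alone does not determine which vertices are openers.  The involution
-- keeps the minimum and the size of every cycle; given these, a linked cycle is
-- determined by its matching.

module Submission where

open import Defs
open import Algebra.Bundles using (CommutativeSemiring)
open import Data.Fin.Base as Fin using (Fin)
import Data.Fin.Properties as Fin
open import Data.List.Base hiding (find)
open import Data.List.Membership.Propositional using (_∈_; find)
open import Data.List.Membership.Propositional.Properties
open import Data.List.Membership.Propositional.Properties.WithK using (unique∧set⇒bag)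
open import Data.List.NonEmpty.Base as List⁺ using (List⁺)
open import Data.List.Properties
open import Data.List.Relation.Binary.BagAndSetEquality using (∼bag⇒↭)
open import Data.List.Relation.Binary.Permutation.Propositional
  using (_↭_; ↭⇒↭ₛ; prep; swap; ↭-refl; ↭-reflexive; ↭-sym; ↭-trans)
import Data.List.Relation.Binary.Permutation.Propositional.Properties as Perm
import Data.List.Relation.Binary.Permutation.Setoid.Properties as PermSetoid
open import Data.List.Relation.Binary.Pointwise as Pointwise using (Pointwise; []; _∷_)
open import Data.List.Relation.Unary.All as All using (All; []; _∷_)
import Data.List.Relation.Unary.All.Properties as All
open import Data.List.Relation.Unary.AllPairs as AllPairs using (AllPairs; []; _∷_)
import Data.List.Relation.Unary.AllPairs.Properties as AllPairs
open import Data.List.Relation.Unary.Any as Any using (Any; here; there)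
open import Data.List.Relation.Unary.Unique.Propositional using (Unique)
import Data.List.Relation.Unary.Unique.Propositional.Properties as Unique
open import Data.Maybe.Base using (Maybe; just; nothing)
open import Data.Nat.Base as ℕ using (ℕ; zero; suc; _≤_; z≤n; s≤s)
import Data.Nat.Properties as ℕ
open import Data.Product.Base using (∃-syntax; _×_; _,_; proj₁; proj₂)
open import Data.Product.Relation.Binary.Lex.Strict using (×-compare)
open import Data.Sum.Base using (_⊎_; inj₁; inj₂)
open import Data.Unit.Base using (⊤; tt)
open import Function.Base using (_∘_; flip; id)
open import Function.Bundles using (mk⇔)
open import Level using (Level; 0ℓ)
open import Relation.Binary.Core using (Rel)
open import Relation.Binary.Definitions using (Transitive; Asymmetric; Tri; tri<; tri≈; tri>)
open import Relation.Binary.PropositionalEquality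
  using (_≡_; _≢_; setoid; isEquivalence; refl; sym; trans; cong; cong₂; subst)
open import Relation.Binary.Structures using (IsStrictTotalOrder)
open import Relation.Nullary using (¬_; yes; no; contradiction)
open import Relation.Unary using (Pred; Decidable)

-- Knuth equivalence and monotone subsequences

-- The direction of the sweep makes every deletion harmless: a largest entry sits in a corner, so
-- removing it needs no sliding and just restricts the Knuth class to the smaller letters.
-- Conversely, a largest entry can be added at any cell where the shape may grow, which is what
-- rebuilding along transposed shapes requires.
--
-- A crossing or nesting has a moment at which all its arcs are open, just after its smallest closer
-- is passed. It is therefore enough to control single monotone subsequences, and their lengths only
-- ask whether a given cell of the first column or first row is ever occupied. Hence a sweep records
-- the cells that change, and shapes are compared only through membership of cells.
--
-- Insertion, deletion and sweeps are relations because each is read in both directions. Conjugation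
-- is a relation as well: it is symmetric since transposing twice is the identity, and functional
-- since sweeps are deterministic both ways. A total, symmetric and functional relation already
-- permutes the summands.

module Knuth {A : Set} (_<_ : Rel A 0ℓ) where

  infix 4 _~_

  data _~_ : Rel (List A) 0ℓ where
    knuth₁ : ∀ {x y z w} → x < y → y < z → (x ∷ z ∷ y ∷ w) ~ (z ∷ x ∷ y ∷ w)
    knuth₂ : ∀ {x y z w} → x < y → y < z → (y ∷ x ∷ z ∷ w) ~ (y ∷ z ∷ x ∷ w)
    ~-cons : ∀ {x v w} → v ~ w → (x ∷ v) ~ (x ∷ w)
    ~-refl : ∀ {w} → w ~ w
    ~-sym : ∀ {v w} → v ~ w → w ~ v
    ~-trans : ∀ {u v w} → u ~ v → v ~ w → u ~ w

  ~⇒↭ : ∀ {v w} → v ~ w → v ↭ w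
  ~⇒↭ (knuth₁ {x} {y} {z} _ _) = swap x z ↭-refl
  ~⇒↭ (knuth₂ {x} {y} {z} _ _) = prep y (swap x z ↭-refl)
  ~⇒↭ (~-cons p)    = prep _ (~⇒↭ p)
  ~⇒↭ ~-refl        = ↭-refl
  ~⇒↭ (~-sym p)     = ↭-sym (~⇒↭ p)
  ~⇒↭ (~-trans p q) = ↭-trans (~⇒↭ p) (~⇒↭ q)

  ~-reflexive : ∀ {v w} → v ≡ w → v ~ w
  ~-reflexive refl = ~-refl

  ~-ʳ++ : ∀ r {v w} → v ~ w → (r ʳ++ v) ~ (r ʳ++ w)
  ~-ʳ++ []      p = p
  ~-ʳ++ (x ∷ r) p = ~-ʳ++ r (~-cons p)

  -- If `z` is lost, the exchange of `x` and `z` disappears; if `z` survives, downward closure keeps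
  -- `x` and the witness `y` too. This is what makes deleting the largest entry compatible with
  -- Knuth equivalence.
  ~-filter : ∀ {P : Pred A 0ℓ} (P? : Decidable P) → (∀ {x y} → x < y → P y → P x) →
             Transitive _<_ → ∀ {v w} → v ~ w → filter P? v ~ filter P? w
  ~-filter P? down <-trans = go
    where
    go : ∀ {v w} → v ~ w → filter P? v ~ filter P? w
    go (knuth₁ {x} {y} {z} x<y y<z) with P? x in ex | P? y in ey | P? z in ez
    ... | no _  | _      | no _   rewrite ez | ex      = ~-refl
    ... | no _  | _      | yes _  rewrite ez | ex      = ~-refl
    ... | yes _ | _      | no _   rewrite ez | ex      = ~-refl
    ... | yes _ | no ¬py | yes pz rewrite ez | ex | ey = contradiction (down y<z pz) ¬py
    ... | yes _ | yes _  | yes _  rewrite ez | ex | ey = knuth₁ x<y y<z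
    go (knuth₂ {x} {y} {z} x<y y<z) with P? x in ex | P? y in ey | P? z in ez
    ... | _     | no ¬py | yes pz = contradiction (down y<z pz) ¬py
    ... | no _  | no _   | no _   rewrite ex | ez | ex = ~-refl
    ... | yes _ | no _   | no _   rewrite ex | ez | ex = ~-refl
    ... | no _  | yes _  | no _   rewrite ex | ez | ex = ~-refl
    ... | no _  | yes _  | yes _  rewrite ex | ez | ex = ~-refl
    ... | yes _ | yes _  | no _   rewrite ex | ez | ex = ~-refl
    ... | yes _ | yes _  | yes _  rewrite ex | ez | ex = knuth₂ x<y y<z
    go (~-cons {x} p) with P? x
    ... | yes _ = ~-cons (go p)
    ... | no  _ = go p
    go ~-refl        = ~-refl
    go (~-sym p)     = ~-sym (go p)
    go (~-trans p q) = ~-trans (go p) (go q)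

-- Reversing the order exchanges the roles of `x` and `z`, which turns each of the two relations
-- into its own converse. Nestings inherit the argument for crossings in this way.
~-flip : ∀ {A : Set} {_<_ : Rel A 0ℓ} {v w} → Knuth._~_ _<_ v w → Knuth._~_ (flip _<_) v w
~-flip (Knuth.knuth₁ p q) = Knuth.~-sym (Knuth.knuth₁ q p)
~-flip (Knuth.knuth₂ p q) = Knuth.~-sym (Knuth.knuth₂ q p)
~-flip (Knuth.~-cons p)    = Knuth.~-cons (~-flip p)
~-flip Knuth.~-refl        = Knuth.~-refl
~-flip (Knuth.~-sym p)     = Knuth.~-sym (~-flip p)
~-flip (Knuth.~-trans p q) = Knuth.~-trans (~-flip p) (~-flip q)

module Chains {A : Set} (_<_ : Rel A 0ℓ) where

  -- The bound P on the first element is what lets ~-chain go under a cons.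

  data Chain : Pred A 0ℓ → List A → ℕ → Set₁ where
    done : ∀ {P} → Chain P [] 0
    omit : ∀ {P x w k} → Chain P w k → Chain P (x ∷ w) k
    pick : ∀ {P x w k} → P x → Chain (x <_) w k → Chain P (x ∷ w) (suc k)

  Closed : Pred A 0ℓ → Set
  Closed P = ∀ {x y} → x < y → P x → P y

  All⊤ : Pred A 0ℓ
  All⊤ _ = ⊤

  empty : ∀ {P} w → Chain P w 0
  empty []      = done
  empty (x ∷ w) = omit (empty w)

  weaken : ∀ {P Q : Pred A 0ℓ} {w k} → (∀ {x} → P x → Q x) → Chain P w k → Chain Q w k
  weaken f done = done
  weaken f (omit c)   = omit (weaken f c)
  weaken f (pick p c) = pick (f p) c

  omits : ∀ r {P w k} → Chain P w k → Chain P (r ʳ++ w) k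
  omits []      c = c
  omits (x ∷ r) c = omits r (omit c)

  module _ (<-trans : Transitive _<_) (<-asym : Asymmetric _<_) where
    open Knuth _<_

    private
      -- Only `x` and `z` change their relative position, so only a chain through both can break; it
      -- is rerouted through the adjacent letter `y`, whose value lies between them. `P` has to be
      -- upward closed because `y` may replace `x` as the first element. The two directions are
      -- mutual on account of `~-sym`.
      to   : ∀ {P v w k} → Closed P → v ~ w → Chain P v k → Chain P w k
      from : ∀ {P v w k} → Closed P → v ~ w → Chain P w k → Chain P v k

      to cl (knuth₁ p q) (omit (omit c))            = omit (omit c)
      to cl (knuth₁ p q) (omit (pick pz (omit c)))  = pick pz (omit (omit c))
      to cl (knuth₁ p q) (omit (pick pz (pick r c))) = contradiction r (<-asym q)
      to cl (knuth₁ p q) (pick px (omit c))          = omit (pick px c)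
      to cl (knuth₁ p q) (pick px (pick r (omit c))) =
        omit (pick px (pick p (weaken (<-trans q) c)))
      to cl (knuth₁ p q) (pick px (pick r (pick s c))) = contradiction s (<-asym q)
      to cl (knuth₂ p q) (omit (omit (omit c)))      = omit (omit (omit c))
      to cl (knuth₂ p q) (omit (omit (pick pz c)))   = omit (pick pz (omit c))
      to cl (knuth₂ p q) (omit (pick px (omit c)))   = omit (omit (pick px c))
      to cl (knuth₂ p q) (omit (pick px (pick r c))) = pick (cl p px) (pick q (omit c))
      to cl (knuth₂ p q) (pick py (omit (omit c)))   = pick py (omit (omit c))
      to cl (knuth₂ p q) (pick py (omit (pick r c))) = pick py (pick r (omit c))
      to cl (knuth₂ p q) (pick py (pick r c))        = contradiction r (<-asym p)
      to cl (~-cons e)    (omit c)   = omit (to cl e c)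
      to cl (~-cons e)    (pick p c) = pick p (to (λ x<y z<x → <-trans z<x x<y) e c)
      to cl ~-refl        c          = c
      to cl (~-sym e)     c          = from cl e c
      to cl (~-trans e f) c          = to cl f (to cl e c)

      from cl (knuth₁ p q) (omit (omit c))            = omit (omit c)
      from cl (knuth₁ p q) (omit (pick px c))         = pick px (omit c)
      from cl (knuth₁ p q) (pick pz (omit (omit c)))  = omit (pick pz (omit c))
      from cl (knuth₁ p q) (pick pz (omit (pick r c))) = contradiction r (<-asym q)
      from cl (knuth₁ p q) (pick pz (pick r c))       = contradiction r (<-asym (<-trans p q))
      from cl (knuth₂ p q) (omit (omit (omit c)))     = omit (omit (omit c))
      from cl (knuth₂ p q) (omit (omit (pick px c)))  = omit (pick px (omit c))
      from cl (knuth₂ p q) (omit (pick pz (omit c)))  = omit (omit (pick pz c))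
      from cl (knuth₂ p q) (omit (pick pz (pick r c))) = contradiction r (<-asym (<-trans p q))
      from cl (knuth₂ p q) (pick py (omit (omit c)))   = pick py (omit (omit c))
      from cl (knuth₂ p q) (pick py (omit (pick r c))) = contradiction r (<-asym p)
      from cl (knuth₂ p q) (pick py (pick r (omit c))) = pick py (omit (pick r c))
      from cl (knuth₂ p q) (pick py (pick r (pick s c))) = contradiction s (<-asym (<-trans p q))
      from cl (~-cons e)    (omit c)   = omit (from cl e c)
      from cl (~-cons e)    (pick p c) = pick p (from (λ x<y z<x → <-trans z<x x<y) e c)
      from cl ~-refl        c          = c
      from cl (~-sym e)     c          = to cl e c
      from cl (~-trans e f) c          = from cl e (from cl f c)

    ~-chain : ∀ {v w k} → v ~ w → Chain All⊤ v k → Chain All⊤ w k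
    ~-chain = to _

    module _ {B : Set} (f : B → A) where

      chain⇒⊆ : ∀ {P} → Closed P → ∀ bs {k} → Chain P (map f bs) k →
                ∃[ cs ] (∀ {S : Rel B 0ℓ} → AllPairs S bs → AllPairs S cs) ×
                        All (_∈ bs) cs × AllPairs (λ b c → f b < f c) cs ×
                        All (P ∘ f) cs × length cs ≡ k
      chain⇒⊆ cl []       done = [] , id , [] , [] , [] , refl
      chain⇒⊆ cl (b ∷ bs) (omit c) with chain⇒⊆ cl bs c
      ... | cs , s , m , r , p , l =
        cs , (λ { (_ ∷ q) → s q }) , All.map there m , r , p , l
      chain⇒⊆ cl (b ∷ bs) (pick p c) with chain⇒⊆ (λ x<y z<x → <-trans z<x x<y) bs c
      ... | cs , s , m , r , q , l =
        b ∷ cs , (λ { (a ∷ as) → All.map (All.lookup a) m ∷ s as }) ,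
        here refl ∷ All.map there m , q ∷ r , p ∷ All.map (λ x<y → cl x<y p) q , cong suc l

      -- Both lists are sorted by the same asymmetric relation, so containment as sets already makes
      -- `cs` a subsequence of `bs`.
      ⊆⇒chain : ∀ {S : Rel B 0ℓ} → Asymmetric S → ∀ {P bs cs} → AllPairs S bs → AllPairs S cs →
                All (_∈ bs) cs → AllPairs (λ b c → f b < f c) cs → All (P ∘ f) cs →
                Chain P (map f bs) (length cs)
      ⊆⇒chain asy {cs = []} sb sc m r p = empty _
      ⊆⇒chain asy {bs = b ∷ bs} {cs = c ∷ cs} (b< ∷ sb) (c< ∷ sc) (here refl ∷ m) (r ∷ rs) (p ∷ ps) =
        pick p (⊆⇒chain asy sb sc (All.zipWith later (c< , m)) rs r)
        where
        later : ∀ {d} → _ × d ∈ b ∷ bs → d ∈ bs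
        later (s , here refl) = contradiction s (asy s)
        later (s , there d∈)  = d∈
      ⊆⇒chain asy {bs = b ∷ bs} {cs = c ∷ cs} (b< ∷ sb) (c< ∷ sc) (there c∈ ∷ m) r p =
        omit (⊆⇒chain asy sb (c< ∷ sc) (c∈ ∷ All.zipWith later (c< , m)) r p)
        where
        later : ∀ {d} → _ × d ∈ b ∷ bs → d ∈ bs
        later (s , here refl) = contradiction s (asy (All.lookup b< c∈))
        later (s , there d∈)  = d∈

-- Tableaux and row insertion

module Tableaux {A : Set} {_<_ : Rel A 0ℓ} (isSTO : IsStrictTotalOrder _≡_ _<_) where
  open IsStrictTotalOrder isSTO using (compare; irrefl; asym; _<?_; _≟_) renaming (trans to <-trans)
  open Knuth _<_
  open Chains using (Chain; Closed; All⊤; done; omit; pick; empty; omits; weaken)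

  Row Tableau : Set
  Row     = List A
  Tableau = List Row

  Cell : Set
  Cell = ℕ × ℕ

  Sorted : Row → Set
  Sorted = AllPairs _<_

  top : Tableau → Row
  top []      = []
  top (r ∷ _) = r

  -- The reading word is the reverse of the usual one, because words grow at
  -- their front when the vertices are swept from right to left.

  reading : Tableau → List A
  reading []      = []
  reading (r ∷ T) = r ʳ++ reading T

  infixr 5 _∷_

  data Above : Row → Row → Set where
    []  : ∀ {r} → Above r []
    _∷_ : ∀ {a b r s} → a < b → Above r s → Above (a ∷ r) (b ∷ s)

  -- Empty rows are excluded so that the number of rows is the length of the first column, and so
  -- that undoing an insertion has a single outcome.
  data Valid : Tableau → Set where
    []  : Valid []
    row : ∀ {r T} → 1 ≤ length r → Sorted r → Above r (top T) → Valid T → Valid (r ∷ T)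

  rowLength : Tableau → ℕ → ℕ
  rowLength []      _       = 0
  rowLength (r ∷ T) zero    = length r
  rowLength (r ∷ T) (suc i) = rowLength T i

  In : Tableau → Cell → Set
  In T (i , j) = j ℕ.< rowLength T i

  data RowInsert : A → Row → Maybe A → Row → Set where
    end  : ∀ {x} → RowInsert x [] nothing (x ∷ [])
    bump : ∀ {x z r} → x < z → RowInsert x (z ∷ r) (just z) (x ∷ r)
    pass : ∀ {x a r m r′} → a < x → RowInsert x r m r′ → RowInsert x (a ∷ r) m (a ∷ r′)

  data Insert : A → Tableau → Cell → Tableau → Set where
    new  : ∀ {x} → Insert x [] (0 , 0) ((x ∷ []) ∷ [])
    stop : ∀ {x r r′ T} → RowInsert x r nothing r′ → Insert x (r ∷ T) (0 , length r) (r′ ∷ T)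
    next : ∀ {x z r r′ i j T U} → RowInsert x r (just z) r′ → Insert z T (i , j) U →
           Insert x (r ∷ T) (suc i , j) (r′ ∷ U)

  -- In use, `x` is the largest entry: read forwards it is added at a cell of one's choice, read
  -- backwards it is deleted.
  data Append : A → Tableau → Cell → Tableau → Set where
    new  : ∀ {x} → Append x [] (0 , 0) ((x ∷ []) ∷ [])
    stop : ∀ {x r r′ T} → RowInsert x r nothing r′ → Append x (r ∷ T) (0 , length r) (r′ ∷ T)
    next : ∀ {x r i j T U} → All (_< x) r → Append x T (i , j) U →
           Append x (r ∷ T) (suc i , j) (r ∷ U)

  record Tab (T : Tableau) : Set where
    constructor tab
    field
      valid  : Valid T
      unique : Unique (reading T)

  private
    variable
      x y z : A
      r r′ s s′ : Row
      T U : Tableau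
      c d : Cell
      m : Maybe A

  length-end : RowInsert x r nothing r′ → length r′ ≡ suc (length r)
  length-end end        = refl
  length-end (pass _ p) = cong suc (length-end p)

  length-bump : RowInsert x r (just z) r′ → length r′ ≡ length r
  length-bump (bump _)   = refl
  length-bump (pass _ p) = cong suc (length-bump p)

  bump-< : RowInsert x r (just z) r′ → x < z
  bump-< (bump p)   = p
  bump-< (pass _ p) = bump-< p

  RowInsert-All : ∀ {P : Pred A 0ℓ} → P x → All P r → RowInsert x r m r′ → All P r′
  RowInsert-All px []       end        = px ∷ []
  RowInsert-All px (_ ∷ ps) (bump _)   = px ∷ ps
  RowInsert-All px (p ∷ ps) (pass _ i) = p ∷ RowInsert-All px ps i

  RowInsert-Sorted : Sorted r → RowInsert x r m r′ → Sorted r′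
  RowInsert-Sorted []       end          = [] ∷ []
  RowInsert-Sorted (p ∷ ps) (bump x<z)   = All.map (<-trans x<z) p ∷ ps
  RowInsert-Sorted (p ∷ ps) (pass a<x i) = RowInsert-All a<x p i ∷ RowInsert-Sorted ps i

  rowInsert : ∀ x r → All (x ≢_) r → ∃[ m ] ∃[ r′ ] RowInsert x r m r′
  rowInsert x []      []       = _ , _ , end
  rowInsert x (a ∷ r) (n ∷ ns) with compare x a
  ... | tri< x<a _ _ = _ , _ , bump x<a
  ... | tri≈ _ x≡a _ = contradiction x≡a n
  ... | tri> _ _ a<x with rowInsert x r ns
  ...   | _ , _ , i = _ , _ , pass a<x i

  append : All (_< x) r → RowInsert x r nothing (r ++ x ∷ [])
  append []       = end
  append (p ∷ ps) = pass p (append ps)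

  end-ʳ++ : RowInsert x r nothing r′ → ∀ {w} → r′ ʳ++ w ≡ x ∷ (r ʳ++ w)
  end-ʳ++ {x} {r} i = go r i
    where
    go : ∀ r {r′} → RowInsert x r nothing r′ → ∀ {w} → r′ ʳ++ w ≡ x ∷ (r ʳ++ w)
    go []      end        = refl
    go (_ ∷ r) (pass _ i) = go r i

  private
    -- Each entry that `x` passes is followed by the next smaller entry of the row, which is the
    -- witness for `knuth₁`.
    ~-past : ∀ q {w} → Sorted (z ∷ q) → x < z → (x ∷ (q ʳ++ (z ∷ w))) ~ (q ʳ++ (x ∷ z ∷ w))
    ~-past []      _                      x<z = ~-refl
    ~-past (b ∷ q) ((z<b ∷ _) ∷ sq) x<z =
      ~-trans (~-past q sq (<-trans x<z z<b)) (~-ʳ++ q (knuth₁ x<z z<b))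

  -- First `x` moves right with `knuth₁` until it stands before `z`; then `z` moves right through
  -- the smaller entries with `knuth₂`. The witness for the latter is the letter to the left of `z`:
  -- at first `x`, afterwards the entry just passed.
  bump-~ : ∀ {w} → Sorted r → RowInsert x r (just z) r′ → (x ∷ (r ʳ++ w)) ~ (r′ ʳ++ (z ∷ w))
  bump-~ {r = _ ∷ q} sr (bump x<z) = ~-past q sr x<z
  bump-~ (_ ∷ sr) (pass {r′ = _ ∷ r″} a<x i@(bump x<z)) =
    ~-trans (bump-~ sr i) (~-ʳ++ r″ (~-sym (knuth₂ a<x x<z)))
  bump-~ ((a<b ∷ _) ∷ sr) (pass {r′ = _ ∷ r″} a<x i@(pass b<x j)) =
    ~-trans (bump-~ sr i) (~-ʳ++ r″ (~-sym (knuth₂ a<b (<-trans b<x (bump-< j)))))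

  insert-~ : Valid T → Insert x T c U → (x ∷ reading T) ~ reading U
  insert-~ v              new        = ~-refl
  insert-~ v              (stop i)   = ~-reflexive (sym (end-ʳ++ i))
  insert-~ (row _ sr _ v) (next {r′ = r′} i j) = ~-trans (bump-~ sr i) (~-ʳ++ r′ (insert-~ v j))

  -- Column-strictness under insertion and its reversal

  Above-length : Above r s → length s ≤ length r
  Above-length []      = z≤n
  Above-length (_ ∷ p) = s≤s (Above-length p)

  Above-lower : RowInsert x r (just z) r′ → Above r s → Above r′ s
  Above-lower i           []      = []
  Above-lower (bump x<z)  (p ∷ a) = <-trans x<z p ∷ a
  Above-lower (pass _ i)  (p ∷ a) = p ∷ Above-lower i a

  Above-raise : RowInsert x r (just z) r′ → All (z <_) s → Above r′ s → Above r s
  Above-raise i          _        []      = []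
  Above-raise (bump _)   (q ∷ _)  (_ ∷ a) = q ∷ a
  Above-raise (pass _ i) (_ ∷ qs) (p ∷ a) = p ∷ Above-raise i qs a

  Above-end : RowInsert x r nothing r′ → Above r s → Above r′ s
  Above-end i          []      = []
  Above-end (pass _ i) (p ∷ a) = p ∷ Above-end i a

  Above-unend : RowInsert x r nothing r′ → length s ≤ length r → Above r′ s → Above r s
  Above-unend i          _       []      = []
  Above-unend (pass _ i) (s≤s l) (p ∷ a) = p ∷ Above-unend i l a

  -- An entry below `z` is larger than `z`, so `z` lands in its old column or further left, where
  -- the entry above is now at most `x` and hence smaller than `z`.
  Above-insert : RowInsert x r (just z) r′ → RowInsert z s m s′ → Above r s → Above r′ s′
  Above-insert (bump x<z)   end        []      = x<z ∷ []
  Above-insert (bump x<z)   (bump _)   (p ∷ a) = x<z ∷ a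
  Above-insert (bump _)     (pass q _) (p ∷ _) = contradiction p (asym q)
  Above-insert (pass a<x i) end        []      = <-trans a<x (bump-< i) ∷ []
  Above-insert (pass a<x i) (bump _)   (_ ∷ a) = <-trans a<x (bump-< i) ∷ Above-lower i a
  Above-insert (pass _ i)   (pass _ j) (p ∷ a) = p ∷ Above-insert i j a

  private
    Above-≮ : RowInsert z s m s′ → All (z <_) r → ¬ Above r s′
    Above-≮ end        (z<a ∷ _) (a<z ∷ _) = asym z<a a<z
    Above-≮ (bump _)   (z<a ∷ _) (a<z ∷ _) = asym z<a a<z
    Above-≮ (pass _ i) (_ ∷ z<r) (_ ∷ a)   = Above-≮ i z<r a

  -- Column-strictness after the insertion rules out that `z` stands to the right of the column it
  -- came from, since the entries above it there would be larger than `z`.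
  Above-uninsert : Sorted r → Sorted s → RowInsert x r (just z) r′ → RowInsert z s m s′ →
                   Above r′ s′ → Above r s
  Above-uninsert sr ss i end a = []
  Above-uninsert sr ss (bump _) (bump q) (_ ∷ a) = q ∷ a
  Above-uninsert (z<r ∷ _) ss (bump _) (pass _ j) (_ ∷ a) = contradiction a (Above-≮ j z<r)
  Above-uninsert sr (b<s ∷ _) (pass _ i) (bump z<b) (p ∷ a) =
    <-trans p z<b ∷ Above-raise i (All.map (<-trans z<b) b<s) a
  Above-uninsert (_ ∷ sr) (_ ∷ ss) (pass _ i) (pass _ j) (p ∷ a) = p ∷ Above-uninsert sr ss i j a

  Above-append : length s ℕ.< length r → All (_< x) r → RowInsert x s nothing s′ →
                 Above r s → Above r s′
  Above-append {r = _ ∷ _} _ (p ∷ _) end        []      = p ∷ []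
  Above-append (s≤s l)     (_ ∷ ps) (pass _ i) (q ∷ a) = q ∷ Above-append l ps i a

  top-insert : Insert x T c U → ∃[ m ] RowInsert x (top T) m (top U)
  top-insert new        = _ , end
  top-insert (stop i)   = _ , i
  top-insert (next i _) = _ , i

  -- This is all that transposition uses about a change of shape: one new cell, with no reference to
  -- entries, in a form symmetric in rows and columns.
  record Extends (T : Tableau) (c : Cell) (U : Tableau) : Set where
    field
      fresh : ¬ In T c
      added : In U c
      ⊇     : ∀ {d} → In T d → In U d
      ⊆     : ∀ {d} → In U d → In T d ⊎ d ≡ c
  open Extends

  extends-new : Extends [] (0 , 0) ((x ∷ []) ∷ [])
  extends-new .fresh ()
  extends-new .added = s≤s z≤n
  extends-new .⊇ ()
  extends-new .⊆ {zero , zero}  _ = inj₂ refl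
  extends-new .⊆ {zero , suc _} (s≤s ())

  extends-stop : length r′ ≡ suc (length r) → Extends (r ∷ T) (0 , length r) (r′ ∷ T)
  extends-stop eq .fresh = ℕ.<-irrefl refl
  extends-stop eq .added = ℕ.≤-reflexive (sym eq)
  extends-stop eq .⊇ {zero , _}  p = ℕ.≤-trans (ℕ.m≤n⇒m≤1+n p) (ℕ.≤-reflexive (sym eq))
  extends-stop eq .⊇ {suc _ , _} p = p
  extends-stop eq .⊆ {zero , j}  p with ℕ.m<1+n⇒m<n∨m≡n (ℕ.≤-trans p (ℕ.≤-reflexive eq))
  ... | inj₁ q = inj₁ q
  ... | inj₂ q = inj₂ (cong (0 ,_) q)
  extends-stop eq .⊆ {suc _ , _} p = inj₁ p

  extends-next : ∀ {i j} → length r′ ≡ length r → Extends T (i , j) U →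
                 Extends (r ∷ T) (suc i , j) (r′ ∷ U)
  extends-next eq e .fresh = e .fresh
  extends-next eq e .added = e .added
  extends-next eq e .⊇ {zero , _}  p = ℕ.≤-trans p (ℕ.≤-reflexive (sym eq))
  extends-next eq e .⊇ {suc i , j} p = e .⊇ {i , j} p
  extends-next eq e .⊆ {zero , _}  p = inj₁ (ℕ.≤-trans p (ℕ.≤-reflexive eq))
  extends-next eq e .⊆ {suc i , j} p with e .⊆ {i , j} p
  ... | inj₁ q    = inj₁ q
  ... | inj₂ refl = inj₂ refl

  insert-extends : Insert x T c U → Extends T c U
  insert-extends new        = extends-new
  insert-extends (stop i)   = extends-stop (length-end i)
  insert-extends (next i j) = extends-next (length-bump i) (insert-extends j)

  append-extends : Append x T c U → Extends T c U
  append-extends new        = extends-new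
  append-extends (stop i)   = extends-stop (length-end i)
  append-extends (next _ j) = extends-next refl (append-extends j)

  In-left : ∀ T {i j} → In T (i , suc j) → In T (i , j)
  In-left T p = ℕ.≤-trans (ℕ.n≤1+n _) p

  In-up : ∀ {i j} → Valid T → In T (suc i , j) → In T (i , j)
  In-up {T = _ ∷ _ ∷ _} {zero} (row _ _ a _) p = ℕ.≤-trans p (Above-length a)
  In-up {i = suc i}            (row _ _ _ v) p = In-up {i = i} v p

  empty-top : Valid T → length (top T) ≤ 0 → T ≡ []
  empty-top []             _ = refl
  empty-top (row ne _ _ _) l = contradiction (ℕ.≤-trans ne l) (λ ())

  top-Sorted : Valid T → Sorted (top T)
  top-Sorted []              = []
  top-Sorted (row _ sr _ _) = sr

  Unique-resp-↭ : ∀ {v w : List A} → v ↭ w → Unique v → Unique w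
  Unique-resp-↭ p = PermSetoid.Unique-resp-↭ (setoid A) (↭⇒↭ₛ p)

  ʳ++-All⁻ : ∀ {P : Pred A 0ℓ} r {w} → All P (r ʳ++ w) → All P r × All P w
  ʳ++-All⁻ r {w} ps = All.++⁻ r (Perm.All-resp-↭ (↭-sym (Perm.++↭ʳ++ r w)) ps)

  ʳ++-Unique⁻ : ∀ (r w : Row) → Unique (r ʳ++ w) → Unique w
  ʳ++-Unique⁻ []      w u = u
  ʳ++-Unique⁻ (x ∷ r) w u = AllPairs.tail (ʳ++-Unique⁻ r (x ∷ w) u)

  ʳ++-fresh : ∀ r w → Unique (r ʳ++ w) → x ∈ w → All (x ≢_) r
  ʳ++-fresh []      w u x∈ = []
  ʳ++-fresh (a ∷ r) w u x∈ =
    (λ { refl → All.lookup (AllPairs.head (ʳ++-Unique⁻ r (a ∷ w) u)) x∈ refl })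
    ∷ ʳ++-fresh r (a ∷ w) u (there x∈)

  -- Insertion

  insert : ∀ T → Valid T → Unique (x ∷ reading T) → ∃[ c ] ∃[ U ] Insert x T c U × Valid U
  insert []      v u = _ , _ , new , row (s≤s z≤n) ([] ∷ []) [] []
  insert {x} (r ∷ T) (row ne sr a v) u@(x∉ ∷ _) with rowInsert x r (proj₁ (ʳ++-All⁻ r x∉))
  ... | nothing , r′ , i = _ , _ , stop i ,
    row (ℕ.≤-trans ne (ℕ.≤-trans (ℕ.n≤1+n _) (ℕ.≤-reflexive (sym (length-end i)))))
        (RowInsert-Sorted sr i) (Above-end i a) v
  ... | just z , r′ , i
    with insert T v (ʳ++-Unique⁻ r′ _ (Unique-resp-↭ (~⇒↭ (bump-~ sr i)) u))
  ...   | _ , _ , j , v′ = _ , _ , next i j ,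
    row (ℕ.≤-trans ne (ℕ.≤-reflexive (sym (length-bump i)))) (RowInsert-Sorted sr i)
        (Above-insert i (proj₂ (top-insert j)) a) v′

  insertTab : Tab T → Unique (x ∷ reading T) → ∃[ c ] ∃[ U ] Insert x T c U × Tab U
  insertTab (tab v _) u with insert _ v u
  ... | _ , _ , i , v′ = _ , _ , i , tab v′ (Unique-resp-↭ (~⇒↭ (insert-~ v i)) u)

  -- Reverse insertion

  private
    unappend : ∀ {j} → Sorted r → length r ≡ suc j → ∃[ x ] ∃[ r₀ ] RowInsert x r₀ nothing r × Sorted r₀
    unappend {a ∷ []}    _ _ = a , [] , end , []
    unappend {a ∷ b ∷ r} {suc j} ((a<b ∷ a<r) ∷ sr) eq with unappend sr (ℕ.suc-injective eq)
    ... | x , [] , end , _ = x , _ , pass a<b end , [] ∷ []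
    ... | x , c ∷ r₀ , pass b<x i , sr₀@(b<r₀ ∷ _) =
      x , _ , pass (<-trans a<b b<x) (pass b<x i) , (a<b ∷ All.map (<-trans a<b) b<r₀) ∷ sr₀

    unbump-All : ∀ {P : Pred A 0ℓ} → RowInsert x r (just z) r′ → P z → All P r′ → P x × All P r
    unbump-All (bump _)   pz (px ∷ ps) = px , pz ∷ ps
    unbump-All (pass _ i) pz (pa ∷ ps) with unbump-All i pz ps
    ... | px , qs = px , pa ∷ qs

    -- `x` is the largest entry smaller than `z`; it exists because the head is smaller than `z`.
    unbump : ∀ {a q} → Sorted (a ∷ q) → a < z → All (z ≢_) q →
             ∃[ x ] ∃[ r ] RowInsert x r (just z) (a ∷ q) × Sorted r
    unbump {q = []} _ a<z _ = _ , _ , bump a<z , [] ∷ []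
    unbump {z} {q = b ∷ q} (a<q@(_ ∷ _) ∷ sq@(b<q ∷ sq′)) a<z (z≢b ∷ z≢q) with compare z b
    ... | tri< z<b _ _ = _ , _ , bump a<z , (z<b ∷ All.map (<-trans z<b) b<q) ∷ sq
    ... | tri≈ _ z≡b _ = contradiction z≡b z≢b
    ... | tri> _ _ b<z with unbump sq b<z z≢q
    ...   | _ , _ , i , sr with unbump-All i a<z a<q
    ...     | a<x , a<r = _ , _ , pass a<x i , a<r ∷ sr

    head-< : RowInsert z s m s′ → Above r s′ → ∃[ a ] ∃[ q ] r ≡ a ∷ q × a < z
    head-< end          (p ∷ _) = _ , _ , refl , p
    head-< (bump _)     (p ∷ _) = _ , _ , refl , p
    head-< (pass b<z _) (p ∷ _) = _ , _ , refl , <-trans p b<z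

  -- The row of the cell gives up its last entry, which is then unbumped through the rows above. The
  -- two negative hypotheses say that the cell is a corner, so that what remains has the shape of a
  -- tableau.
  uninsert : ∀ i {j} → Valid U → Unique (reading U) → In U (i , j) →
             ¬ In U (i , suc j) → ¬ In U (suc i , j) →
             ∃[ x ] ∃[ T ] Insert x T (i , j) U × Valid T
  uninsert zero {j} (row {r} {T} ne sr a v) u in′ ¬right ¬up
    with ℕ.≤-antisym (ℕ.≮⇒≥ ¬right) in′
  ... | eq with unappend sr eq
  ...   | x , r₀ , i , sr₀ with ℕ.suc-injective (trans (sym (length-end i)) eq)
  uninsert zero (row {r} {[]} ne sr a v) u in′ ¬right ¬up
        | eq | x , [] , end , sr₀ | refl = x , [] , new , []
  uninsert zero (row {r} {T} ne sr a v) u in′ ¬right ¬up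
        | eq | x , r₀@(_ ∷ _) , i , sr₀ | refl = x , _ , stop i ,
          row (s≤s z≤n) sr₀ (Above-unend i (below v ¬up) a) v
    where
    below : ∀ {T j} → Valid T → ¬ In T (0 , j) → length (top T) ≤ j
    below []            _ = z≤n
    below (row _ _ _ _) n = ℕ.≮⇒≥ n
  uninsert zero (row {r} {s ∷ T} ne sr a (row ne′ _ _ _)) u in′ ¬right ¬up
        | eq | x , [] , end , sr₀ | refl = contradiction ne′ ¬up
  uninsert (suc i) (row {r} {U} ne sr a v) u in′ ¬right ¬up
    with uninsert i v (ʳ++-Unique⁻ r _ u) in′ ¬right ¬up
  ... | z , T , ins , v′ with head-< (proj₂ (top-insert ins)) a
  ...   | b , q , refl , b<z
    with unbump sr b<z (All.tail (ʳ++-fresh r _ u (Perm.∈-resp-↭ (~⇒↭ (insert-~ v′ ins)) (here refl))))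
  ...     | x , r₀ , j , sr₀ = x , _ , next j ins ,
    row (ℕ.≤-trans ne (ℕ.≤-reflexive (length-bump j))) sr₀
        (Above-uninsert sr₀ (top-Sorted v′) j (proj₂ (top-insert ins)) a) v′

  uninsertTab : ∀ {i j} → Tab U → In U (i , j) → ¬ In U (i , suc j) → ¬ In U (suc i , j) →
                ∃[ x ] ∃[ T ] Insert x T (i , j) U × Tab T × Unique (x ∷ reading T)
  uninsertTab (tab v u) in′ ¬right ¬up with uninsert _ v u in′ ¬right ¬up
  ... | x , T , i , v′ with Unique-resp-↭ (↭-sym (~⇒↭ (insert-~ v′ i))) u
  ...   | u′@(_ ∷ uT) = x , T , i , tab v′ uT , u′

  -- Appending and deleting the largest entry

  append-reading : Append x T c U → reading U ↭ x ∷ reading T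
  append-reading new = ↭-refl
  append-reading (stop i) = ↭-reflexive (end-ʳ++ i)
  append-reading {x = x} (next {r = r} _ j) =
    ↭-trans (↭-sym (Perm.++↭ʳ++ r _)) (↭-trans (Perm.++⁺ˡ r (append-reading j))
      (↭-trans (Perm.shift x r _) (prep x (Perm.++↭ʳ++ r _))))

  private
    filter-ʳ++ : ∀ {P : Pred A 0ℓ} (P? : Decidable P) r {w} → All P r →
                 filter P? (r ʳ++ w) ≡ r ʳ++ filter P? w
    filter-ʳ++ P? []      []       = refl
    filter-ʳ++ P? (a ∷ r) (p ∷ ps) =
      trans (filter-ʳ++ P? r ps) (cong (r ʳ++_) (filter-accept P? p))

  -- The other letters of the reading word keep their order, so deletion from the tableau is exactly
  -- the restriction to smaller letters treated by `~-filter`.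
  append-filter : Append x T c U → All (_< x) (reading T) → filter (_<? x) (reading U) ≡ reading T
  append-filter {x} new _ = filter-reject (_<? x) (irrefl refl)
  append-filter {x} (stop i) T<x = trans (cong (filter (_<? x)) (end-ʳ++ i))
    (trans (filter-reject (_<? x) (irrefl refl)) (filter-all (_<? x) T<x))
  append-filter {x} (next {r = r} r<x j) T<x = trans (filter-ʳ++ (_<? x) r r<x)
    (cong (r ʳ++_) (append-filter j (proj₂ (ʳ++-All⁻ r T<x))))

  top-append : Append x T c U → top T ≡ top U ⊎ RowInsert x (top T) nothing (top U)
  top-append new        = inj₂ end
  top-append (stop i)   = inj₂ i
  top-append (next _ _) = inj₁ refl

  private
    Above-shorten : RowInsert x s nothing s′ → Above r s′ → Above r s
    Above-shorten end        _       = []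
    Above-shorten (pass _ i) (p ∷ a) = p ∷ Above-shorten i a

    -- Nothing can stand below an entry that no entry of the next row exceeds, so the cell of `x` is
    -- a corner.
    Above-max : RowInsert x r nothing r′ → All (λ a → ¬ x < a) s → Above r′ s →
                length s ≤ length r
    Above-max _          _        []        = z≤n
    Above-max end        (p ∷ _)  (x<b ∷ _) = contradiction x<b p
    Above-max (pass _ i) (_ ∷ ps) (_ ∷ a)   = s≤s (Above-max i ps a)

    deleteRow : Sorted r → All (λ a → ¬ x < a) r → x ∈ r →
                ∃[ r₀ ] RowInsert x r₀ nothing r × Sorted r₀
    deleteRow {a ∷ []}    _ _ (here refl) = [] , end , []
    deleteRow {a ∷ b ∷ r} ((a<b ∷ _) ∷ _) (_ ∷ p ∷ _) (here refl) = contradiction a<b p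
    deleteRow {a ∷ r} (a<r ∷ sr) (_ ∷ ps) (there x∈) with deleteRow sr ps x∈
    ... | r₀ , i , sr₀ = a ∷ r₀ , pass (All.lookup a<r x∈) i , before i a<r ∷ sr₀
      where
      before : ∀ {P : Pred A 0ℓ} {r₀ r} → RowInsert x r₀ nothing r → All P r → All P r₀
      before end        _        = []
      before (pass _ i) (p ∷ ps) = p ∷ before i ps

    delete : Valid U → All (λ a → ¬ x < a) (reading U) → x ∈ reading U →
             ∃[ c ] ∃[ T ] Append x T c U × Valid T
    delete {x = x} (row {r} {U} ne sr a v) max x∈ with Any.any? (x ≟_) r
    ... | yes x∈r with deleteRow sr (proj₁ (ʳ++-All⁻ r max)) x∈r
    ...   | r₀ , i , sr₀ = finish r₀ i sr₀ v (Above-max i (max-top U (proj₂ (ʳ++-All⁻ r max))) a)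
      where
      max-top : ∀ U → All (λ a → ¬ x < a) (reading U) → All (λ a → ¬ x < a) (top U)
      max-top []      _   = []
      max-top (r ∷ _) max = proj₁ (ʳ++-All⁻ r max)

      finish : ∀ r₀ → RowInsert x r₀ nothing r → Sorted r₀ → Valid U → length (top U) ≤ length r₀ →
               ∃[ c ] ∃[ T ] Append x T c (r ∷ U) × Valid T
      finish [] end _ v l with refl ← empty-top v l = _ , _ , new , []
      finish r₀@(_ ∷ _) i sr₀ v l = _ , _ , stop i , row (s≤s z≤n) sr₀ (Above-unend i l a) v
    delete {x = x} (row {r} {U} ne sr a v) max x∈ | no x∉r
      with delete v (proj₂ (ʳ++-All⁻ r max)) (rest (∈-++⁻ r (Perm.∈-resp-↭ (↭-sym (Perm.++↭ʳ++ r _)) x∈)))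
      where
      rest : ∀ {w} → x ∈ r ⊎ x ∈ w → x ∈ w
      rest (inj₁ x∈r) = contradiction x∈r x∉r
      rest (inj₂ x∈w) = x∈w
    ... | _ , T , j , v′ = _ , _ , next (All.tabulate smaller) j , row ne sr (above (top-append j)) v′
      where
      smaller : ∀ {b} → b ∈ r → b < x
      smaller {b} b∈ with compare b x
      ... | tri< b<x _ _  = b<x
      ... | tri≈ _ refl _ = contradiction b∈ x∉r
      ... | tri> _ _ x<b  = contradiction x<b (All.lookup (proj₁ (ʳ++-All⁻ r max)) b∈)

      above : top T ≡ top U ⊎ RowInsert x (top T) nothing (top U) → Above r (top T)
      above (inj₁ eq) = subst (Above r) (sym eq) a
      above (inj₂ i)  = Above-shorten i a

  deleteTab : Tab U → All (λ a → ¬ x < a) (reading U) → x ∈ reading U →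
              ∃[ c ] ∃[ T ] Append x T c U × All (_< x) (reading T) × Tab T
  deleteTab {x = x} (tab v u) max x∈ with delete v max x∈
  ... | c , T , p , v′
    with Unique-resp-↭ (append-reading p) u | Perm.All-resp-↭ (append-reading p) max
  ...   | x∉ ∷ uT | _ ∷ maxT = c , T , p , All.zipWith smaller (x∉ , maxT) , tab v′ uT
    where
    smaller : ∀ {b} → x ≢ b × ¬ x < b → b < x
    smaller {b} (x≢b , x≮b) with compare b x
    ... | tri< b<x _ _ = b<x
    ... | tri≈ _ b≡x _ = contradiction (sym b≡x) x≢b
    ... | tri> _ _ x<b = contradiction x<b x≮b

  -- As `x` exceeds every entry, the order conditions at the new cell are automatic and only the
  -- shape matters: the last two hypotheses provide the cells above and to the left.
  extend : ∀ i {j} → Valid U → All (_< x) (reading U) → ¬ In U (i , j) →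
           (∀ {a} → i ≡ suc a → In U (a , j)) → (∀ {b} → j ≡ suc b → In U (i , b)) →
           ∃[ T ] Append x U (i , j) T × Valid T
  extend zero    {zero}  [] _ _ _ _ = _ , new , row (s≤s z≤n) ([] ∷ []) [] []
  extend zero    {suc j} [] _ _ _ b = contradiction (b refl) λ ()
  extend (suc i)         [] _ _ a _ = contradiction (a refl) λ ()
  extend zero {j} (row {r} ne sr ab v) U<x ¬in _ left
    with ℕ.≤-antisym (ℕ.≮⇒≥ ¬in) (at-end j left)
    where
    at-end : ∀ j → (∀ {b} → j ≡ suc b → In (r ∷ []) (0 , b)) → j ≤ length r
    at-end zero    _ = z≤n
    at-end (suc j) f = f refl
  ... | refl = _ , stop i ,
    row (ℕ.≤-trans (s≤s z≤n) (ℕ.≤-reflexive (sym (length-end i)))) (RowInsert-Sorted sr i) (Above-end i ab) v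
    where i = append (proj₁ (ʳ++-All⁻ r U<x))
  extend {x = x} (suc i) {j} (row {r} {U} ne sr ab v) U<x ¬in below left
    with extend i v (proj₂ (ʳ++-All⁻ r U<x)) ¬in (λ { refl → below refl }) left
  ... | T , p , v′ = _ , next r<x p , row ne sr (above i p below) v′
    where
    r<x = proj₁ (ʳ++-All⁻ r U<x)

    above : ∀ i {j} → Append x U (i , j) T → (∀ {a} → suc i ≡ suc a → In (r ∷ U) (a , j)) → Above r (top T)
    above _ new        below = Above-append (below refl) r<x end ab
    above _ (stop e)   below = Above-append (below refl) r<x e ab
    above _ (next _ _) below = ab

  extendTab : ∀ {i j} → Tab U → All (_< x) (reading U) → ¬ In U (i , j) →
              (∀ {a} → i ≡ suc a → In U (a , j)) → (∀ {b} → j ≡ suc b → In U (i , b)) →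
              ∃[ T ] Append x U (i , j) T × Tab T
  extendTab (tab v u) U<x ¬in below left with extend _ v U<x ¬in below left
  ... | T , p , v′ = T , p , tab v′ (Unique-resp-↭ (↭-sym (append-reading p))
    (All.map (λ a<x x≡a → irrefl (sym x≡a) a<x) U<x ∷ u))

  -- Monotone subsequences of a reading word

  private
    shorten : ∀ {R : Rel A 0ℓ} {P w k l} → l ≤ k → Chain R P w k → Chain R P w l
    shorten z≤n     c          = empty _ _
    shorten l       (omit c)   = omit (shorten l c)
    shorten (s≤s l) (pick p c) = pick p (shorten l c)

    -- Rows are read from top to bottom, so the first column occurs in the word in increasing order.
    column-chain : ∀ {P m} → All P (top T) → Valid T → In T (m , 0) →
                   Chain _<_ P (reading T) (suc m)
    column-chain {m = zero} (p ∷ _) (row {r = a ∷ r} _ _ _ _) _ =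
      omits _ r (pick p (empty _ _))
    column-chain {m = suc m} (p ∷ _) (row {r = a ∷ r} {T = (b ∷ s) ∷ T} _ _ (a<b ∷ _) v@(row _ (b<s ∷ _) _ _)) q =
      omits _ r (pick p (column-chain (a<b ∷ All.map (<-trans a<b) b<s) v q))
    column-chain {m = suc m} _ (row {T = [] ∷ T} _ _ _ (row () _ _ _)) q
    column-chain {m = zero} [] (row () _ _ _) _
    column-chain {m = suc m} [] (row () _ _ _) _

    -- A row is read in decreasing order, so an increasing chain takes at most one entry `b` from
    -- it.
    split-row : ∀ {P k} r {w} → Sorted r → Chain _<_ P (r ʳ++ w) k →
                Chain _<_ P w k ⊎ (∃[ b ] ∃[ l ] b ∈ r × k ≡ suc l × Chain _<_ (b <_) w l)
    split-row []      _         c = inj₁ c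
    split-row (a ∷ r) (a<r ∷ sr) c with split-row r sr c
    ... | inj₁ (omit c′)   = inj₁ c′
    ... | inj₁ (pick p c′) = inj₂ (a , _ , here refl , refl , c′)
    ... | inj₂ (b , l , b∈ , eq , omit c′)     = inj₂ (b , l , there b∈ , eq , c′)
    ... | inj₂ (b , l , b∈ , eq , pick b<a c′) = contradiction b<a (asym (All.lookup a<r b∈))

    column-bound : ∀ {P k} → Valid T → Chain _<_ P (reading T) k → k ≤ length T
    column-bound []                      done = z≤n
    column-bound (row {r = r} _ sr _ v) c with split-row r sr c
    ... | inj₁ c′ = ℕ.m≤n⇒m≤1+n (column-bound v c′)
    ... | inj₂ (_ , _ , _ , refl , c′) = s≤s (column-bound v c′)

    In-column : ∀ m → Valid T → suc m ≤ length T → In T (m , 0)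
    In-column zero    (row ne _ _ _) _       = ne
    In-column (suc m) (row _ _ _ v)  (s≤s l) = In-column m v l

  chain⇒column : ∀ {m} → Tab T → Chain _<_ (All⊤ _<_) (reading T) (suc m) → In T (m , 0)
  chain⇒column t c = In-column _ (Tab.valid t) (column-bound (Tab.valid t) c)

  column⇒chain : ∀ {m} → Tab T → In T (m , 0) → Chain _<_ (All⊤ _<_) (reading T) (suc m)
  column⇒chain t = column-chain (All.tabulate λ _ → tt) (Tab.valid t)

  private
    _>_ : Rel A 0ℓ
    _>_ = flip _<_

    row-chain : ∀ {k} r {w} → Sorted r → Chain _>_ (λ y → All (y <_) r) w k →
                Chain _>_ (All⊤ _>_) (r ʳ++ w) (length r ℕ.+ k)
    row-chain []      _         c = weaken _ (λ _ → tt) c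
    row-chain {k} (a ∷ r) (a<r ∷ sr) c =
      subst (Chain _>_ _ _) (ℕ.+-suc (length r) k)
        (row-chain r sr (pick a<r (weaken _ All.head c)))

    data Low (P : Pred A 0ℓ) : Row → ℕ → Set where
      zero : Low P r 0
      suc  : ∀ {a k} → P a → Low P r k → Low P (a ∷ r) (suc k)

    -- In a reading word, each step of a decreasing subsequence moves strictly to
    -- the left, so its first element is in the k-th column or further right,
    -- where k is its length: the first k entries of the top row are at most it.

    Bounds : Row → List A → Set₁
    Bounds r w = ∀ {P k} → Closed _>_ P → Chain _>_ P w k → Low P r k

    -- The first `k` entries are smaller than `a`, which itself lies in the row; so the next entry
    -- exists and is at most `a`, and `P` passes down to it.
    low-suc : ∀ {P a k} → Closed _>_ P → Sorted r → a ∈ r → P a → Low (_< a) r k → Low P r (suc k)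
    low-suc cl _         (here refl) pa zero        = suc pa zero
    low-suc cl (b<r ∷ _) (there a∈)  pa zero        = suc (cl (All.lookup b<r a∈) pa) zero
    low-suc cl _         (here refl) pa (suc a<a _) = contradiction a<a (irrefl refl)
    low-suc cl (_ ∷ sr)  (there a∈)  pa (suc b<a l) = suc (cl b<a pa) (low-suc cl sr a∈ pa l)

    -- The letters of the row are put in front of the word one at a time, while the bound always
    -- refers to the whole row `r`; this is why `s` is separate.
    bounds-row : ∀ {w} → Sorted r → ∀ s → All (_∈ r) s → Bounds r w → Bounds r (s ʳ++ w)
    bounds-row sr []      []        b = b
    bounds-row {r} {w} sr (a ∷ s) (a∈ ∷ s∈) b = bounds-row sr s s∈ b′
      where
      b′ : Bounds r (a ∷ w)
      b′ cl (omit c)   = b cl c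
      b′ cl (pick p c) = low-suc cl sr a∈ p (b (λ z<y y<a → <-trans z<y y<a) c)

    low-above : ∀ {P k} → Closed _>_ P → Above r s → Low P s k → Low P r k
    low-above cl a       zero      = zero
    low-above cl (p ∷ a) (suc q l) = suc (cl p q) (low-above cl a l)

    bounds : Valid T → Bounds (top T) (reading T)
    bounds []                      cl done = zero
    bounds (row {r} _ sr a v) = bounds-row sr r (All.tabulate id) (λ cl c → low-above cl a (bounds v cl c))

    low-length : ∀ {P k} → Low P r k → k ≤ length r
    low-length zero      = z≤n
    low-length (suc _ l) = s≤s (low-length l)

  chain⇒row : ∀ {m} → Tab T → Chain _>_ (All⊤ _>_) (reading T) (suc m) → In T (0 , m)
  chain⇒row {T = []}    t ()
  chain⇒row {T = _ ∷ _} t c = low-length (bounds (Tab.valid t) (λ _ _ → tt) c)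

  row⇒chain : ∀ {m} → Tab T → In T (0 , m) → Chain _>_ (All⊤ _>_) (reading T) (suc m)
  row⇒chain (tab (row {r} _ sr _ _) _) q =
    shorten (ℕ.≤-trans q (ℕ.m≤m+n _ 0)) (row-chain r sr (empty _ _))

-- Sweeping a matching from right to left

module Sweeps {A : Set} {_<_ : Rel A 0ℓ} (isSTO : IsStrictTotalOrder _≡_ _<_) where
  open IsStrictTotalOrder isSTO using (compare; irrefl; asym; _<?_; _≟_) renaming (trans to <-trans)
  open Knuth _<_
  open Chains using (Chain; All⊤)
  open Tableaux isSTO
  open Extends

  _ᵗ : Cell → Cell
  (i , j) ᵗ = j , i

  data Event : Set where
    opener closer : A → Event

  vertex : Event → A
  vertex (opener x) = x
  vertex (closer y) = y

  Arcs : Set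
  Arcs = List (A × A)

  infix 4 _<ᵉ_

  _<ᵉ_ : A → List Event → Set
  x <ᵉ es = All (λ e → x < vertex e) es

  -- In Sweep es B v T cs, the events es have been passed, B are the arcs whose
  -- closers have been passed, v are those of them whose openers have not, T is
  -- the tableau with these openers as entries, and cs are the cells in which
  -- the tableau has grown (at closers) or shrunk (at openers).

  data Sweep : List Event → Arcs → Arcs → Tableau → List Cell → Set where
    end   : Sweep [] [] [] [] []
    close : ∀ {x y es B v T c U cs} → Sweep es B v T cs → y <ᵉ es → x < y →
            Unique (x ∷ reading T) → Insert x T c U → Tab U → All (_< y) (reading U) →
            Sweep (closer y ∷ es) ((x , y) ∷ B) ((x , y) ∷ v) U (c ∷ cs)
    open′ : ∀ {x es B v T c U cs} → Sweep es B v T cs → x <ᵉ es →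
            Append x U c T → Tab U → All (_< x) (reading U) →
            Sweep (opener x ∷ es) B (filter (λ α → proj₁ α <? x) v) U (c ∷ cs)

  private
    variable
      x y : A
      α β : A × A
      es : List Event
      B B′ v v′ αs : Arcs
      T T′ U U′ : Tableau
      c c′ : Cell
      cs cs′ : List Cell

  filter-map : ∀ {C : Set} {P : Pred A 0ℓ} (P? : Decidable P) (f : C → A) ws →
               filter P? (map f ws) ≡ map f (filter (P? ∘ f) ws)
  filter-map P? f []       = refl
  filter-map P? f (w ∷ ws) with P? (f w)
  ... | yes _ = cong (f w ∷_) (filter-map P? f ws)
  ... | no  _ = filter-map P? f ws

  sweep-tab : Sweep es B v T cs → Tab T
  sweep-tab end                   = tab [] []
  sweep-tab (close _ _ _ _ _ t _) = t
  sweep-tab (open′ _ _ _ t _)     = t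

  sweep-~ : Sweep es B v T cs → reading T ~ map proj₁ v
  sweep-~ end = ~-refl
  sweep-~ (close s _ _ _ i _ _) =
    ~-trans (~-sym (insert-~ (Tab.valid (sweep-tab s)) i)) (~-cons (sweep-~ s))
  sweep-~ (open′ {x} {v = v} s _ p _ U<x) =
    ~-trans (~-reflexive (sym (append-filter p U<x)))
    (~-trans (~-filter (_<? x) <-trans <-trans (sweep-~ s))
    (~-reflexive (filter-map (_<? x) proj₁ v)))

  -- The tableau starts empty, so each of its cells was recorded when it was added.
  sweep-In : Sweep es B v T cs → In T c → c ∈ cs
  sweep-In end ()
  sweep-In (close s _ _ _ i _ _) q with insert-extends i .⊆ q
  ... | inj₁ q′   = there (sweep-In s q′)
  ... | inj₂ refl = here refl
  sweep-In (open′ s _ p _ _) q = there (sweep-In s (append-extends p .⊇ q))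

  active⇒entry : Sweep es B v T cs → α ∈ v → proj₁ α ∈ reading T
  active⇒entry s α∈ = Perm.∈-resp-↭ (↭-sym (~⇒↭ (sweep-~ s))) (∈-map⁺ proj₁ α∈)

  entry⇒active : Sweep es B v T cs → x ∈ reading T → ∃[ y ] (x , y) ∈ v
  entry⇒active s x∈ with ∈-map⁻ proj₁ (Perm.∈-resp-↭ (~⇒↭ (sweep-~ s)) x∈)
  ... | (_ , y) , α∈ , refl = y , α∈

  active⊆ : Sweep es B v T cs → α ∈ v → α ∈ B
  active⊆ (close s _ _ _ _ _ _) (here eq)  = here eq
  active⊆ (close s _ _ _ _ _ _) (there α∈) = there (active⊆ s α∈)
  active⊆ (open′ {x} s _ _ _ _) α∈ = active⊆ s (proj₁ (∈-filter⁻ (λ α → proj₁ α <? x) α∈))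

  active-< : Sweep es B v T cs → α ∈ v → proj₁ α <ᵉ es
  active-< (close s y<es x<y _ _ _ _) (here refl) = x<y ∷ All.map (<-trans x<y) y<es
  active-< (close {y = y} s _ _ _ i _ U<y) (there α∈) =
    All.lookup U<y (Perm.∈-resp-↭ (~⇒↭ (insert-~ (Tab.valid (sweep-tab s)) i))
      (there (active⇒entry s α∈))) ∷ active-< s α∈
  active-< (open′ {x} {v = v} s _ _ _ _) α∈ with ∈-filter⁻ (λ α → proj₁ α <? x) {xs = v} α∈
  ... | α∈v , α<x = α<x ∷ active-< s α∈v

  -- An arc stops being active only when its opener is passed, and the opener is then an event.
  active : Sweep es B v T cs → α ∈ B → proj₁ α <ᵉ es → α ∈ v
  active (close s _ _ _ _ _ _) (here eq)  _        = here eq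
  active (close s _ _ _ _ _ _) (there α∈) (_ ∷ p)  = there (active s α∈ p)
  active (open′ {x} s _ _ _ _) α∈ (α<x ∷ p) = ∈-filter⁺ (λ α → proj₁ α <? x) (active s α∈ p) α<x

  closer∈ : Sweep es B v T cs → α ∈ B → closer (proj₂ α) ∈ es
  closer∈ (close s _ _ _ _ _ _) (here refl) = here refl
  closer∈ (close s _ _ _ _ _ _) (there α∈)  = there (closer∈ s α∈)
  closer∈ (open′ s _ _ _ _)     α∈          = there (closer∈ s α∈)

  ∈closer : Sweep es B v T cs → closer y ∈ es → ∃[ x ] (x , y) ∈ B
  ∈closer (close s _ _ _ _ _ _) (here refl) = _ , here refl
  ∈closer (close s _ _ _ _ _ _) (there y∈) with ∈closer s y∈
  ... | x , α∈ = x , there α∈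
  ∈closer (open′ s _ _ _ _)     (there y∈) = ∈closer s y∈

  opener∈ : Sweep es B v T cs → α ∈ B → opener (proj₁ α) ∈ es ⊎ α ∈ v
  opener∈ (close s _ _ _ _ _ _) (here refl) = inj₂ (here refl)
  opener∈ (close s _ _ _ _ _ _) (there α∈) with opener∈ s α∈
  ... | inj₁ x∈  = inj₁ (there x∈)
  ... | inj₂ α∈v = inj₂ (there α∈v)
  opener∈ (open′ {x} s _ p _ U<x) α∈ with opener∈ s α∈
  ... | inj₁ x∈  = inj₁ (there x∈)
  ... | inj₂ α∈v with Perm.∈-resp-↭ (append-reading p) (active⇒entry s α∈v)
  ...   | here refl = inj₁ (here refl)
  ...   | there α∈U = inj₂ (∈-filter⁺ (λ α → proj₁ α <? x) α∈v (All.lookup U<x α∈U))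

  ∈opener : Sweep es B v T cs → opener x ∈ es → ∃[ y ] (x , y) ∈ B
  ∈opener (close s _ _ _ _ _ _) (there x∈) with ∈opener s x∈
  ... | y , α∈ = y , there α∈
  ∈opener (open′ s _ p _ _) (here refl)
    with entry⇒active s (Perm.∈-resp-↭ (↭-sym (append-reading p)) (here refl))
  ... | y , α∈ = y , active⊆ s α∈
  ∈opener (open′ s _ _ _ _) (there x∈) = ∈opener s x∈

  arc-< : Sweep es B v T cs → α ∈ B → proj₁ α < proj₂ α
  arc-< (close s _ x<y _ _ _ _) (here refl) = x<y
  arc-< (close s _ _ _ _ _ _)   (there α∈)  = arc-< s α∈
  arc-< (open′ s _ _ _ _)       α∈          = arc-< s α∈

  closer-< : Sweep es B v T cs → y <ᵉ es → All (λ α → y < proj₂ α) B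
  closer-< s y<es = All.tabulate (λ α∈ → All.lookup y<es (closer∈ s α∈))

  arcs-sorted : Sweep es B v T cs → AllPairs (λ α β → proj₂ α < proj₂ β) B
  arcs-sorted end                      = []
  arcs-sorted (close s y<es _ _ _ _ _) = closer-< s y<es ∷ arcs-sorted s
  arcs-sorted (open′ s _ _ _ _)        = arcs-sorted s

  active-sorted : Sweep es B v T cs → AllPairs (λ α β → proj₂ α < proj₂ β) v
  active-sorted end = []
  active-sorted (close s y<es _ _ _ _ _) =
    All.tabulate (λ α∈ → All.lookup (closer-< s y<es) (active⊆ s α∈)) ∷ active-sorted s
  active-sorted (open′ {x} s _ _ _ _) = AllPairs.filter⁺ (λ α → proj₁ α <? x) (active-sorted s)

  events-sorted : Sweep es B v T cs → AllPairs (λ e f → vertex e < vertex f) es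
  events-sorted end                      = []
  events-sorted (close s y<es _ _ _ _ _) = y<es ∷ events-sorted s
  events-sorted (open′ s x<es _ _ _)     = x<es ∷ events-sorted s

  record IsMatching (B : Arcs) : Set where
    field
      increasing : ∀ {x y} → (x , y) ∈ B → x < y
      functional : ∀ {x y z} → (x , z) ∈ B → (y , z) ∈ B → x ≡ y
      injective  : ∀ {x y z} → (x , y) ∈ B → (x , z) ∈ B → y ≡ z
      disjoint   : ∀ {x y z} → (x , y) ∈ B → ¬ (y , z) ∈ B

  sorted-≡ : ∀ {C : Set} {R : Rel C 0ℓ} {xs} → Asymmetric R → AllPairs R xs →
             ∀ {a b} → a ∈ xs → b ∈ xs → ¬ R a b → ¬ R b a → a ≡ b
  sorted-≡ asy (r ∷ rs) (here refl) (here refl) n n′ = refl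
  sorted-≡ asy (r ∷ rs) (here refl) (there b∈)  n n′ = contradiction (All.lookup r b∈) n
  sorted-≡ asy (r ∷ rs) (there a∈)  (here refl) n n′ = contradiction (All.lookup r a∈) n′
  sorted-≡ asy (r ∷ rs) (there a∈)  (there b∈)  n n′ = sorted-≡ asy rs a∈ b∈ n n′

  sorted-unique : ∀ {C : Set} {R : Rel C 0ℓ} {xs ys} → Asymmetric R → AllPairs R xs → AllPairs R ys →
                  (∀ {z} → z ∈ xs → z ∈ ys) → (∀ {z} → z ∈ ys → z ∈ xs) → xs ≡ ys
  sorted-unique {xs = []}     {[]}     asy rs ss f g = refl
  sorted-unique {xs = []}     {y ∷ ys} asy rs ss f g = contradiction (g (here refl)) λ ()
  sorted-unique {xs = x ∷ xs} {[]}     asy rs ss f g = contradiction (f (here refl)) λ ()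
  sorted-unique {R = R} {x ∷ xs} {y ∷ ys} asy (r ∷ rs) (s ∷ ss) f g with head′ (f (here refl)) (g (here refl))
    where
    head′ : x ∈ y ∷ ys → y ∈ x ∷ xs → x ≡ y
    head′ (here eq)  _          = eq
    head′ (there _)  (here eq)  = sym eq
    head′ (there x∈) (there y∈) = contradiction (All.lookup r y∈) (asy (All.lookup s x∈))
  ... | refl = cong (x ∷_) (sorted-unique asy rs ss (tail′ r f) (tail′ s g))
    where
    tail′ : ∀ {us vs} → All (R x) us → (∀ {z} → z ∈ x ∷ us → z ∈ x ∷ vs) → ∀ {z} → z ∈ us → z ∈ vs
    tail′ r f z∈ with f (there z∈)
    ... | there z∈′ = z∈′
    ... | here refl = contradiction (All.lookup r z∈) (λ p → asy p p)

  -- The premises stored in a sweep suffice, so this also applies to a sweep obtained by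
  -- transposition, whose arcs are not known beforehand.
  matching : Sweep es B v T cs → IsMatching B
  matching {es = es} {B} s = record
    { increasing = arc-< s
    ; functional = λ p q → cong proj₁ (sorted-≡ asym (arcs-sorted s) p q (irrefl refl) (irrefl refl))
    ; injective  = inj s
    ; disjoint   = λ p q → disj q (closer∈ s p)
    }
    where
    fresh′ : ∀ {es B v T cs x y} → Sweep es B v T cs → Unique (x ∷ reading T) → x <ᵉ es → ¬ (x , y) ∈ B
    fresh′ s (x∉ ∷ _) x<es α∈ with opener∈ s α∈
    ... | inj₁ x∈  = irrefl refl (All.lookup x<es x∈)
    ... | inj₂ α∈v = All.lookup x∉ (active⇒entry s α∈v) refl

    inj : ∀ {es B v T cs x y z} → Sweep es B v T cs → (x , y) ∈ B → (x , z) ∈ B → y ≡ z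
    inj (close s y<es x<y u _ _ _) (here refl) (here refl) = refl
    inj (close s y<es x<y u _ _ _) (here refl) (there q)   =
      contradiction q (fresh′ s u (All.map (<-trans x<y) y<es))
    inj (close s y<es x<y u _ _ _) (there p)   (here refl) =
      contradiction p (fresh′ s u (All.map (<-trans x<y) y<es))
    inj (close s y<es x<y u _ _ _) (there p)   (there q)   = inj s p q
    inj (open′ s _ _ _ _) p q = inj s p q

    -- If the arc opened by `y` is active, then `y` precedes all events; otherwise one vertex
    -- carries both an opener and a closer event.
    disj : ∀ {y z} → (y , z) ∈ B → ¬ closer y ∈ es
    disj q y∈ with opener∈ s q
    ... | inj₂ q∈v = irrefl refl (All.lookup (active-< s q∈v) y∈)
    ... | inj₁ y∈′ with sorted-≡ asym (events-sorted s) y∈ y∈′ (irrefl refl) (irrefl refl)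
    ...   | ()

  -- Determinism

  private
    RowInsert-functional : ∀ {x r m m′ r′ r″} → RowInsert x r m r′ → RowInsert x r m′ r″ →
                           m ≡ m′ × r′ ≡ r″
    RowInsert-functional end        end        = refl , refl
    RowInsert-functional (bump _)   (bump _)   = refl , refl
    RowInsert-functional (bump p)   (pass q _) = contradiction p (asym q)
    RowInsert-functional (pass q _) (bump p)   = contradiction p (asym q)
    RowInsert-functional (pass _ i) (pass _ j) with RowInsert-functional i j
    ... | refl , refl = refl , refl

    insert-functional : Insert x T c U → Insert x T c′ U′ → c ≡ c′ × U ≡ U′
    insert-functional new new = refl , refl
    insert-functional (stop i) (stop j) with RowInsert-functional i j
    ... | _ , refl = refl , refl
    insert-functional (stop i) (next j _) with RowInsert-functional i j
    ... | () , _
    insert-functional (next i _) (stop j) with RowInsert-functional i j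
    ... | () , _
    insert-functional (next i k) (next j l) with RowInsert-functional i j
    ... | refl , refl with insert-functional k l
    ...   | refl , refl = refl , refl

    end-injective : ∀ {x y r r′ s} → RowInsert x r nothing s → RowInsert y r′ nothing s → x ≡ y × r ≡ r′
    end-injective end        end        = refl , refl
    end-injective (pass _ ()) end
    end-injective end        (pass _ ())
    end-injective (pass _ i) (pass _ j) with end-injective i j
    ... | refl , refl = refl , refl

    end-∈ : ∀ {x r s} → RowInsert x r nothing s → x ∈ s
    end-∈ end        = here refl
    end-∈ (pass _ i) = there (end-∈ i)

    append-injective : Append x T c U → Append x T′ c′ U → Valid T → Valid T′ →
                       c ≡ c′ × T ≡ T′
    append-injective new new _ _ = refl , refl
    append-injective new (stop end) _ (row () _ _ _)
    append-injective (stop end) new (row () _ _ _) _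
    append-injective new (next (x<x ∷ _) _) _ _ = contradiction x<x (irrefl refl)
    append-injective (next (x<x ∷ _) _) new _ _ = contradiction x<x (irrefl refl)
    append-injective (stop i) (stop j) _ _ with end-injective i j
    ... | _ , refl = refl , refl
    append-injective (stop i) (next r<x _) _ _ = contradiction (All.lookup r<x (end-∈ i)) (irrefl refl)
    append-injective (next r<x _) (stop i) _ _ = contradiction (All.lookup r<x (end-∈ i)) (irrefl refl)
    append-injective (next _ p) (next _ q) (row _ _ _ v) (row _ _ _ w) with append-injective p q v w
    ... | refl , refl = refl , refl

    append-functional : Append x T c U → Append x T c U′ → U ≡ U′
    append-functional new        new        = refl
    append-functional (stop i)   (stop j)   with RowInsert-functional i j
    ... | _ , refl = refl
    append-functional (next _ p) (next _ q) = cong (_ ∷_) (append-functional p q)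

    bump-∈ : ∀ {x r m s} → RowInsert x r m s → x ∈ s
    bump-∈ end        = here refl
    bump-∈ (bump _)   = here refl
    bump-∈ (pass _ i) = there (bump-∈ i)

    unbump-unique : ∀ {x y r r′ s z} → Sorted r → Sorted r′ →
                    RowInsert x r (just z) s → RowInsert y r′ (just z) s → x ≡ y × r ≡ r′
    unbump-unique _ _ (bump _) (bump _) = refl , refl
    unbump-unique (z<r ∷ _) _ (bump _) (pass _ j) =
      contradiction (bump-< j) (asym (All.lookup z<r (bump-∈ j)))
    unbump-unique _ (z<r ∷ _) (pass _ i) (bump _) =
      contradiction (bump-< i) (asym (All.lookup z<r (bump-∈ i)))
    unbump-unique (_ ∷ s) (_ ∷ s′) (pass _ i) (pass _ j) with unbump-unique s s′ i j
    ... | refl , refl = refl , refl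

    -- The row index is enough, since the last entry of that row is the one to be removed, and
    -- reverse bumping through the rows above is forced.
    uninsert-unique : Valid T → Valid T′ → proj₁ c ≡ proj₁ c′ → Insert x T c U → Insert y T′ c′ U →
                      x ≡ y × T ≡ T′
    uninsert-unique _ _ _ new new = refl , refl
    uninsert-unique _ (row () _ _ _) _ new (stop end)
    uninsert-unique (row () _ _ _) _ _ (stop end) new
    uninsert-unique _ _ _ (stop i) (stop j) with end-injective i j
    ... | refl , refl = refl , refl
    uninsert-unique (row _ s _ v) (row _ s′ _ v′) eq (next i k) (next j l)
      with uninsert-unique v v′ (ℕ.suc-injective eq) k l
    ... | refl , refl with unbump-unique s s′ i j
    ...   | refl , refl = refl , refl

  sweep-functional : Sweep es B v T cs → Sweep es B v′ T′ cs′ → T ≡ T′ × cs ≡ cs′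
  sweep-functional end end = refl , refl
  sweep-functional (close s _ _ _ i _ _) (close s′ _ _ _ i′ _ _) with sweep-functional s s′
  ... | refl , refl with insert-functional i i′
  ...   | refl , refl = refl , refl
  sweep-functional (open′ s _ p t _) (open′ s′ _ p′ t′ _) with sweep-functional s s′
  ... | refl , refl with append-injective p p′ (Tab.valid t) (Tab.valid t′)
  ...   | refl , refl = refl , refl

  -- The last step is undone first: at a closer the cell determines the inserted opener and the
  -- previous tableau, and at an opener it determines where the vertex goes back.
  sweep-injective : Sweep es B v T cs → Sweep es B′ v′ T cs → B ≡ B′
  sweep-injective end end = refl
  sweep-injective (close s _ _ _ i _ _) (close s′ _ _ _ i′ _ _)
    with uninsert-unique (Tab.valid (sweep-tab s)) (Tab.valid (sweep-tab s′)) refl i i′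
  ... | refl , refl = cong (_ ∷_) (sweep-injective s s′)
  sweep-injective (open′ s _ p _ _) (open′ s′ _ p′ _ _) with append-functional p p′
  ... | refl = sweep-injective s s′

  -- Transposition

  Transposed : Tableau → Tableau → Set
  Transposed T T′ = (∀ {c} → In T c → In T′ (c ᵗ)) × (∀ {c} → In T′ c → In T (c ᵗ))

  private
    transposed-< : ∀ {c} → Extends T c U → Extends T′ (c ᵗ) U′ → Transposed U U′ → ∀ {d} → In T d → In T′ (d ᵗ)
    transposed-< {c = c} e e′ (f , g) {d} q with e′ .⊆ (f {d} (e .⊇ q))
    ... | inj₁ q′ = q′
    ... | inj₂ refl = contradiction q (e .fresh)

    transposed-> : ∀ {c} → Extends T c U → Extends T′ (c ᵗ) U′ → Transposed T T′ → ∀ {d} → In U d → In U′ (d ᵗ)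
    transposed-> {c = c} e e′ (f , g) {d} q with e .⊆ q
    ... | inj₁ q′   = e′ .⊇ (f {d} q′)
    ... | inj₂ refl = e′ .added

    corner-right : ∀ {i j} → Valid T → Extends T (i , j) U → ¬ In U (i , suc j)
    corner-right {T = T} v e q with e .⊆ q
    ... | inj₁ q′ = e .fresh (In-left T q′)
    ... | inj₂ eq = contradiction (cong proj₂ eq) (ℕ.1+n≢n)

    corner-up : ∀ {i j} → Valid T → Extends T (i , j) U → ¬ In U (suc i , j)
    corner-up {i = i} v e q with e .⊆ q
    ... | inj₁ q′ = e .fresh (In-up {i = i} v q′)
    ... | inj₂ eq = contradiction (cong proj₁ eq) (ℕ.1+n≢n)

    cocorner-left : ∀ {i j} → Extends T (i , suc j) U → In T (i , j)
    cocorner-left {U = U} e with e .⊆ (In-left U (e .added))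
    ... | inj₁ q  = q
    ... | inj₂ eq = contradiction (sym (cong proj₂ eq)) ℕ.1+n≢n

    cocorner-up : ∀ {i j} → Valid U → Extends T (suc i , j) U → In T (i , j)
    cocorner-up {i = i} v e with e .⊆ (In-up {i = i} v (e .added))
    ... | inj₁ q  = q
    ... | inj₂ eq = contradiction (sym (cong proj₁ eq)) ℕ.1+n≢n

  -- The events are retraced from left to right. At a closer an insertion is undone at the
  -- transposed corner, and the entry that comes out opens the new arc; at an opener the vertex is
  -- added at the transposed cell. Keeping all entries below the events still ahead makes each added
  -- vertex the largest entry and puts each opener before its closer.
  transpose : Sweep es B v T cs → Tab T′ → Transposed T T′ →
              All (λ e → All (_< vertex e) (reading T′)) es →
              ∃[ B′ ] ∃[ v′ ] Sweep es B′ v′ T′ (map _ᵗ cs)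
  transpose {T′ = []} end _ _ _ = [] , [] , end
  transpose {T′ = _ ∷ _} end (tab (row ne _ _ _) _) (_ , g) _ = contradiction (g {0 , 0} ne) λ ()
  transpose {T′ = U′} (close {c = i , j} s y<es _ _ ins t _) t′ tr@(f , g) (U′<y ∷ U′<es) =
    step (uninsertTab t′ (f (e .added)) (corner-up (Tab.valid (sweep-tab s)) e ∘ g)
           (corner-right (Tab.valid (sweep-tab s)) e ∘ g))
    where
    e = insert-extends ins

    step : (∃[ x ] ∃[ T ] Insert x T (j , i) U′ × Tab T × Unique (x ∷ reading T)) → _
    step (x , T₀ , ins′ , t₀ , u) with transpose s t₀
      (transposed-< e e′ tr , transposed-< e′ e (g , f)) (All.map (All.tail ∘ All↭) U′<es)
      where
      e′ = insert-extends ins′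
      All↭ : ∀ {P : Pred A 0ℓ} → All P (reading U′) → All P (x ∷ reading T₀)
      All↭ = Perm.All-resp-↭ (↭-sym (~⇒↭ (insert-~ (Tab.valid t₀) ins′)))
    ... | B′ , v′ , s′ = _ , _ , close s′ y<es
      (All.head (Perm.All-resp-↭ (↭-sym (~⇒↭ (insert-~ (Tab.valid t₀) ins′))) U′<y)) u ins′ t′ U′<y
  transpose {T′ = U′} (open′ {x} {c = i , j} s x<es p t _) t′ tr@(f , g) (U′<x ∷ U′<es) =
    step (extendTab t′ U′<x (e .fresh ∘ g) (λ { refl → f (cocorner-left e) })
           (λ { refl → f (cocorner-up (Tab.valid (sweep-tab s)) e) }))
    where
    e = append-extends p

    step : (∃[ T ] Append x U′ (j , i) T × Tab T) → _
    step (T₀ , p′ , t₀) with transpose s t₀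
      (transposed-> e e′ tr , transposed-> e′ e (g , f))
      (All.zipWith (λ (x< , U′<) → Perm.All-resp-↭ (↭-sym (append-reading p′)) (x< ∷ U′<)) (x<es , U′<es))
      where e′ = append-extends p′
    ... | B′ , v′ , s′ = _ , _ , open′ s′ x<es p′ t′ U′<x

  -- Crossings and nestings

  -- For R = _<_ these are the crossings and for R = flip _<_ the nestings, both
  -- listed by increasing closers.

  record IsFan (R : Rel A 0ℓ) (αs : Arcs) : Set where
    constructor fan
    field
      openers-chain  : AllPairs (λ α β → R (proj₁ α) (proj₁ β)) αs
      closers-sorted : AllPairs (λ α β → proj₂ α < proj₂ β) αs
      separated      : ∀ {α β} → α ∈ αs → β ∈ αs → proj₁ α < proj₂ β

  module Fans (R : Rel A 0ℓ) (R-trans : Transitive R) (R-asym : Asymmetric R)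
    (~⇒~ᴿ : ∀ {v w} → v ~ w → Knuth._~_ R v w) (cell : ℕ → Cell)
    (chain⇒cell : ∀ {T m} → Tab T → Chain R (All⊤ R) (reading T) (suc m) → In T (cell m))
    (cell⇒chain : ∀ {T m} → Tab T → In T (cell m) → Chain R (All⊤ R) (reading T) (suc m))
    where
    open Chains R using (~-chain; chain⇒⊆; ⊆⇒chain)

    -- Active openers precede every event passed, in particular all closers of active arcs, so a
    -- monotone subsequence of the current word is separated.
    active-fan : ∀ {m} → Sweep es B v T cs → In T (cell m) →
                 ∃[ αs ] IsFan R αs × All (_∈ B) αs × length αs ≡ suc m
    active-fan {v = v} s q
      with chain⇒⊆ R-trans R-asym proj₁ (λ _ _ → tt) v
             (~-chain R-trans R-asym (~⇒~ᴿ (sweep-~ s)) (cell⇒chain (sweep-tab s) q))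
    ... | αs , sub , αs∈ , r , _ , len = αs , fan r (sub (active-sorted s)) sep , αs∈B , len
      where
      αs∈B = All.map (active⊆ s) αs∈

      sep : ∀ {α β} → α ∈ αs → β ∈ αs → proj₁ α < proj₂ β
      sep α∈ β∈ = All.lookup (active-< s (All.lookup αs∈ α∈)) (closer∈ s (All.lookup αs∈B β∈))

    -- A recorded cell lies in the tableau right after the insertion that adds it, or right before
    -- the deletion that removes it.
    fan-attained : ∀ {m} → Sweep es B v T cs → cell m ∈ cs →
                   ∃[ αs ] IsFan R αs × All (_∈ B) αs × length αs ≡ suc m
    fan-attained {m = m} s₀@(close s _ _ _ i _ _) (here refl) =
      active-fan s₀ (insert-extends i .added)
    fan-attained (close s _ _ _ _ _ _) (there c∈) with fan-attained s c∈
    ... | αs , f , αs∈ , len = αs , f , All.map there αs∈ , len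
    fan-attained (open′ s _ p _ _) (here refl) =
      active-fan s (append-extends p .added)
    fan-attained (open′ s _ _ _ _) (there c∈) = fan-attained s c∈

    -- The first arc has the smallest closer. When that closer has just been passed, separation
    -- makes all arcs of the fan active, so their openers form a chain in the current word.
    fan-cell : ∀ {m} → Sweep es B v T cs → IsFan R αs → All (_∈ B) αs → length αs ≡ suc m → cell m ∈ cs
    fan-cell {αs = _ ∷ _} s₀@(close {y = y} {B = B} {v} s y<es _ _ _ _ _) (fan r cl@(c ∷ _) sep) αs∈@(here refl ∷ _) refl =
      sweep-In s₀ (chain⇒cell (sweep-tab s₀)
        (~-chain R-trans R-asym (Knuth.~-sym (~⇒~ᴿ (sweep-~ s₀)))
          (⊆⇒chain R-trans R-asym proj₁ asym (active-sorted s₀) cl (All.tabulate in-v) r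
            (All.tabulate λ _ → tt))))
      where
      in-v : ∀ {β} → β ∈ _ → β ∈ _ ∷ v
      in-v β∈ with All.lookup αs∈ β∈
      ... | here eq   = here eq
      ... | there β∈B = there (active s β∈B (All.map (<-trans (sep β∈ (here refl))) y<es))
    fan-cell {αs = _ ∷ _} (close {y = y} s y<es _ _ _ _ _) f@(fan r (c ∷ _) sep) (there α∈ ∷ αs∈) refl =
      there (fan-cell s f (α∈ ∷ All.zipWith older (c , αs∈)) refl)
      where
      older : ∀ {β} → _ × β ∈ _ → β ∈ _
      older (_ , there β∈)    = β∈
      older (α<β , here refl) = contradiction α<β (asym (All.lookup (closer-< s y<es) α∈))
    fan-cell (open′ s _ _ _ _) f αs∈ len = there (fan-cell s f αs∈ len)
    fan-cell {αs = _ ∷ _} end _ (() ∷ _) _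

  -- Closers increase along the word, so increasing openers mean crossing arcs and decreasing
  -- openers nested ones; in this reading order they are measured by the first column and the first
  -- row.
  module Crossings = Fans _<_ <-trans asym id (_, 0) chain⇒column column⇒chain
  module Nestings  = Fans (flip _<_) (flip <-trans) asym ~-flip (0 ,_) chain⇒row row⇒chain

  infix 4 _≐_

  record _≐_ (B B′ : Arcs) : Set where
    constructor ≐-intro
    field
      ⇒ : ∀ {α} → α ∈ B → α ∈ B′
      ⇐ : ∀ {α} → α ∈ B′ → α ∈ B
  open _≐_ public

  ≐-sym : B ≐ B′ → B′ ≐ B
  ≐-sym e = ≐-intro (e .⇐) (e .⇒)

  ≐-trans : B ≐ B′ → B′ ≐ αs → B ≐ αs
  ≐-trans e f = ≐-intro (f .⇒ ∘ e .⇒) (e .⇐ ∘ f .⇐)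

  -- Existence

  Endpoint : Arcs → A → Set
  Endpoint M x = (∃[ y ] (x , y) ∈ M) ⊎ (∃[ y ] (y , x) ∈ M)

  endpoints : Arcs → List A
  endpoints M = map proj₁ M ++ map proj₂ M

  sort : ∀ xs → ∃[ ys ] Sorted ys × (∀ {z} → z ∈ xs → z ∈ ys)
  sort []       = [] , [] , λ ()
  sort (x ∷ xs) with sort xs
  ... | ys , sys , f with place ys sys
    where
    place : ∀ ys → Sorted ys → ∃[ zs ] Sorted zs × x ∈ zs × (∀ {z} → z ∈ ys → z ∈ zs) ×
            (∀ {a} → a < x → All (a <_) ys → All (a <_) zs)
    place [] [] = x ∷ [] , [] ∷ [] , here refl , (λ ()) , λ p _ → p ∷ []
    place (y ∷ ys) sys@(y<ys ∷ sys′) with compare x y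
    ... | tri< x<y _ _  = x ∷ y ∷ ys , (x<y ∷ All.map (<-trans x<y) y<ys) ∷ sys , here refl , there , _∷_
    ... | tri≈ _ refl _ = y ∷ ys , sys , here refl , id , λ _ ps → ps
    ... | tri> _ _ y<x with place ys sys′
    ...   | zs , szs , x∈ , f , g = y ∷ zs , g y<x y<ys ∷ szs , there x∈ ,
            (λ { (here eq) → here eq ; (there z∈) → there (f z∈) }) , λ { p (q ∷ qs) → q ∷ g p qs }
  ...   | zs , szs , x∈ , g , _ = zs , szs , λ { (here refl) → x∈ ; (there z∈) → g (f z∈) }

  module _ {M : Arcs} (isM : IsMatching M) where
    open IsMatching isM

    private
      UpperSet : List A → Set
      UpperSet L = ∀ {z} → Endpoint M z → z ∈ L ⊎ All (z <_) L

      -- The state after the positions in `L` have been passed: the arcs swept are those that close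
      -- in `L`, and the active ones among them open to the left of `L`.
      record Swept (L : List A) : Set where
        field
          {events} : List Event
          {swept active′} : Arcs
          {tableau} : Tableau
          {cells}   : List Cell
          run     : Sweep events swept active′ tableau cells
          events∈ : All (λ e → vertex e ∈ L) events
          sound   : ∀ {α} → α ∈ swept → α ∈ M
          complete : ∀ {α} → α ∈ M → proj₂ α ∈ L → α ∈ swept
          active-sound : ∀ {α} → α ∈ active′ → All (proj₁ α <_) L
          active-complete : ∀ {α} → α ∈ M → proj₂ α ∈ L → All (proj₁ α <_) L → α ∈ active′

      is-opener? : ∀ x → (∃[ y ] (x , y) ∈ M) ⊎ (∀ {y} → ¬ (x , y) ∈ M)
      is-opener? x with Any.any? (λ α → proj₁ α ≟ x) M
      ... | no n = inj₂ (λ α∈ → n (Any.map (λ { refl → refl }) α∈))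
      ... | yes p with find p
      ...   | (_ , y) , α∈ , refl = inj₁ (y , α∈)

      is-closer? : ∀ x → (∃[ y ] (y , x) ∈ M) ⊎ (∀ {y} → ¬ (y , x) ∈ M)
      is-closer? x with Any.any? (λ α → proj₂ α ≟ x) M
      ... | no n = inj₂ (λ α∈ → n (Any.map (λ { refl → refl }) α∈))
      ... | yes p with find p
      ...   | (y , _) , α∈ , refl = inj₁ (y , α∈)

      sweep : ∀ L → Sorted L → UpperSet L → Swept L
      sweep [] _ _ = record
        { run = end ; events∈ = [] ; sound = λ () ; complete = λ _ () ; active-sound = λ ()
        ; active-complete = λ _ () }
      sweep (e ∷ L) (e<L ∷ sL) up = step (is-opener? e) (is-closer? e)
        where
        up′ : UpperSet L
        up′ z with up z
        ... | inj₁ (here refl) = inj₂ e<L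
        ... | inj₁ (there z∈)  = inj₁ z∈
        ... | inj₂ (_ ∷ z<L)   = inj₂ z<L

        open Swept (sweep L sL up′)

        e<events : e <ᵉ events
        e<events = All.map (All.lookup e<L) events∈

        below : ∀ {α} → α ∈ active′ → proj₁ α ≡ e ⊎ proj₁ α < e
        below α∈ with up (inj₁ (_ , sound (active⊆ run α∈)))
        ... | inj₁ (here eq)  = inj₁ eq
        ... | inj₁ (there z∈) = contradiction (All.lookup (active-sound α∈) z∈) (irrefl refl)
        ... | inj₂ (p ∷ _)    = inj₂ p

        entries : ∀ {P : Pred A 0ℓ} → (∀ {α} → α ∈ active′ → P (proj₁ α)) → All P (reading tableau)
        entries f = All.tabulate (λ x∈ → f (proj₂ (entry⇒active run x∈)))

        unswept : ∀ {x} → ¬ (x , e) ∈ swept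
        unswept α∈ = irrefl refl (All.lookup e<L (All.lookup events∈ (closer∈ run α∈)))

        step : (∃[ y ] (e , y) ∈ M) ⊎ (∀ {y} → ¬ (e , y) ∈ M) →
               (∃[ x ] (x , e) ∈ M) ⊎ (∀ {x} → ¬ (x , e) ∈ M) → Swept (e ∷ L)
        step (inj₁ (_ , p)) (inj₁ (_ , q)) = contradiction p (disjoint q)
        -- `L` is only known to contain all endpoints; any other vertex is passed without an event.
        step (inj₂ n) (inj₂ n′) = record
          { run = run
          ; events∈ = All.map there events∈
          ; sound = sound
          ; complete = λ { α∈ (here refl) → contradiction α∈ n′ ; α∈ (there y∈) → complete α∈ y∈ }
          ; active-sound = λ α∈ → smaller α∈ ∷ active-sound α∈
          ; active-complete = λ { α∈ (here refl) _ → contradiction α∈ n′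
                                ; α∈ (there y∈) (_ ∷ p) → active-complete α∈ y∈ p }
          }
          where
          smaller : ∀ {α} → α ∈ active′ → proj₁ α < e
          smaller α∈ with below α∈
          ... | inj₁ refl = contradiction (sound (active⊆ run α∈)) n
          ... | inj₂ p    = p
        step (inj₂ n) (inj₁ (x , α₀∈)) = finish (insertTab (sweep-tab run) (new′ ∷ Tab.unique (sweep-tab run)))
          where
          x<e = increasing α₀∈

          smaller : ∀ {α} → α ∈ active′ → proj₁ α < e
          smaller α∈ with below α∈
          ... | inj₁ refl = contradiction (sound (active⊆ run α∈)) n
          ... | inj₂ p    = p

          -- An entry equal to `x` would open a swept arc, which by injectivity closes at `e`; but
          -- `e` has not been passed yet.
          new′ : All (x ≢_) (reading tableau)
          new′ = entries λ { α∈ refl → unswept (subst (λ y → (x , y) ∈ swept)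
            (injective (sound (active⊆ run α∈)) α₀∈) (active⊆ run α∈)) }

          finish : (∃[ c ] ∃[ U ] Insert x tableau c U × Tab U) → Swept (e ∷ L)
          finish (c , U , i , t) = record
            { run = close run e<events x<e (new′ ∷ Tab.unique (sweep-tab run)) i t
                (Perm.All-resp-↭ (~⇒↭ (insert-~ (Tab.valid (sweep-tab run)) i)) (x<e ∷ entries smaller))
            ; events∈ = here refl ∷ All.map there events∈
            ; sound = λ { (here refl) → α₀∈ ; (there α∈) → sound α∈ }
            ; complete = λ { α∈ (here refl) → here (cong (_, e) (functional α∈ α₀∈))
                           ; α∈ (there y∈) → there (complete α∈ y∈) }
            ; active-sound = λ { (here refl) → x<e ∷ All.map (<-trans x<e) e<L
                               ; (there α∈) → smaller α∈ ∷ active-sound α∈ }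
            ; active-complete = λ { α∈ (here refl) _ → here (cong (_, e) (functional α∈ α₀∈))
                                  ; α∈ (there y∈) (_ ∷ p) → there (active-complete α∈ y∈ p) }
            }
        step (inj₁ (y , α₀∈)) (inj₂ n′) = finish (deleteTab (sweep-tab run) (entries max)
            (active⇒entry run (active-complete α₀∈ y∈L e<L)))
          where
          y∈L : y ∈ L
          y∈L with up (inj₂ (_ , α₀∈))
          ... | inj₁ (here refl) = contradiction (increasing α₀∈) (irrefl refl)
          ... | inj₁ (there y∈)  = y∈
          ... | inj₂ (y<e ∷ _)   = contradiction y<e (asym (increasing α₀∈))

          max : ∀ {α} → α ∈ active′ → ¬ e < proj₁ α
          max α∈ with below α∈
          ... | inj₁ refl = irrefl refl
          ... | inj₂ p    = asym p

          finish : (∃[ c ] ∃[ U ] Append e U c tableau × All (_< e) (reading U) × Tab U) → Swept (e ∷ L)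
          finish (c , U , p , U<e , t) = record
            { run = open′ run e<events p t U<e
            ; events∈ = here refl ∷ All.map there events∈
            ; sound = sound
            ; complete = λ { α∈ (here refl) → contradiction α∈ n′ ; α∈ (there y∈) → complete α∈ y∈ }
            ; active-sound = λ α∈ → let α∈v , α<e = ∈-filter⁻ (λ α → proj₁ α <? e) {xs = active′} α∈
                                    in α<e ∷ active-sound α∈v
            ; active-complete = λ { α∈ (here refl) _ → contradiction α∈ n′
                                  ; α∈ (there y∈) (q ∷ p) →
                                      ∈-filter⁺ (λ α → proj₁ α <? e) (active-complete α∈ y∈ p) q }
            }

    full-sweep : ∃[ es ] ∃[ B ] ∃[ cs ] Sweep es B [] [] cs × B ≐ M
    full-sweep with sort (endpoints M)
    ... | L , sL , f = finish (sweep L sL (inj₁ ∘ endpoint))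
      where
      endpoint : ∀ {z} → Endpoint M z → z ∈ L
      endpoint (inj₁ (_ , α∈)) = f (∈-++⁺ˡ (∈-map⁺ proj₁ α∈))
      endpoint (inj₂ (_ , α∈)) = f (∈-++⁺ʳ (map proj₁ M) (∈-map⁺ proj₂ α∈))

      finish : Swept L → ∃[ es ] ∃[ B ] ∃[ cs ] Sweep es B [] [] cs × B ≐ M
      -- A remaining active opener would lie to the left of all endpoints, itself included.
      finish record { active′ = α ∷ _ ; run = run ; sound = sound ; active-sound = a } =
        contradiction (All.lookup (a (here refl)) (endpoint (inj₁ (_ , sound (active⊆ run (here refl))))))
          (irrefl refl)
      finish record { active′ = [] ; tableau = [] ; run = run ; sound = sound ; complete = complete } =
        _ , _ , _ , run , ≐-intro sound (λ α∈ → complete α∈ (endpoint (inj₂ (_ , α∈))))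
      finish record { active′ = [] ; tableau = (x ∷ r) ∷ T ; run = run } =
        contradiction (proj₂ (entry⇒active run (Perm.∈-resp-↭ (Perm.++↭ʳ++ (x ∷ r) _) (here refl)))) λ ()
      finish record { active′ = [] ; tableau = [] ∷ T ; run = run } with sweep-tab run
      ... | tab (row () _ _ _) _

  IsMatching-resp : B ≐ B′ → IsMatching B → IsMatching B′
  IsMatching-resp e m = record
    { increasing = λ p → increasing (e .⇐ p)
    ; functional = λ p q → functional (e .⇐ p) (e .⇐ q)
    ; injective  = λ p q → injective (e .⇐ p) (e .⇐ q)
    ; disjoint   = λ p q → disjoint (e .⇐ p) (e .⇐ q)
    }
    where open IsMatching m

  -- Conjugate matchings

  -- Arcs are compared as sets, since a sweep lists them by closers and a linked cycle lists them by
  -- cycles.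
  record Conjugate (M M′ : Arcs) : Set where
    field
      {events}     : List Event
      {arcs₁ arcs₂} : Arcs
      {cells}      : List Cell
      sweep₁       : Sweep events arcs₁ [] [] cells
      sweep₂       : Sweep events arcs₂ [] [] (map _ᵗ cells)
      arcs₁≐       : arcs₁ ≐ M
      arcs₂≐       : arcs₂ ≐ M′

  map-ᵗ-involutive : ∀ cs → map _ᵗ (map _ᵗ cs) ≡ cs
  map-ᵗ-involutive cs = trans (sym (map-∘ cs)) (map-id cs)

  conjugate-sym : ∀ {M M′} → Conjugate M M′ → Conjugate M′ M
  conjugate-sym c = record
    { sweep₁ = sweep₂
    ; sweep₂ = subst (Sweep _ _ _ _) (sym (map-ᵗ-involutive _)) sweep₁
    ; arcs₁≐ = arcs₂≐
    ; arcs₂≐ = arcs₁≐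
    }
    where open Conjugate c

  conjugate-resp : ∀ {M M′ M″} → M′ ≐ M″ → Conjugate M M′ → Conjugate M M″
  conjugate-resp e c = record { Conjugate c hiding (arcs₂≐) ; arcs₂≐ = ≐-trans (Conjugate.arcs₂≐ c) e }

  conjugate-exists : ∀ {M} → IsMatching M → ∃[ M′ ] Conjugate M M′
  conjugate-exists isM with full-sweep isM
  ... | es , B , cs , s , e with transpose s (tab [] []) ((λ ()) , λ ()) (All.tabulate λ _ → [])
  ...   | B′ , v′ , s′ = B′ , record
    { sweep₁ = s
    ; sweep₂ = subst (λ v → Sweep es B′ v [] (map _ᵗ cs)) (no-entries v′ s′) s′
    ; arcs₁≐ = e
    ; arcs₂≐ = ≐-intro id id
    }
    where
    no-entries : ∀ v → Sweep es B′ v [] (map _ᵗ cs) → v ≡ []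
    no-entries []      _ = refl
    no-entries (_ ∷ _) s = contradiction (active⇒entry s (here refl)) λ ()

  module _ {M M′} (c : Conjugate M M′) where
    open Conjugate c

    conjugate-matching : IsMatching M′
    conjugate-matching = IsMatching-resp arcs₂≐ (matching sweep₂)

    conjugate-opener : ∀ {x y} → (x , y) ∈ M → ∃[ z ] (x , z) ∈ M′
    conjugate-opener α∈ with opener∈ sweep₁ (arcs₁≐ .⇐ α∈)
    ... | inj₁ x∈ with ∈opener sweep₂ x∈
    ...   | z , β∈ = z , arcs₂≐ .⇒ β∈

    conjugate-closer : ∀ {x y} → (x , y) ∈ M → ∃[ z ] (z , y) ∈ M′
    conjugate-closer α∈ with ∈closer sweep₂ (closer∈ sweep₁ (arcs₁≐ .⇐ α∈))
    ... | z , β∈ = z , arcs₂≐ .⇒ β∈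

    -- Transposition turns the cells of the first column into those of the first row. The empty
    -- crossing is separate because a cell stands for a positive length.
    crossing⇒nesting : ∀ {αs} → IsFan _<_ αs → All (_∈ M) αs →
                       ∃[ βs ] IsFan (flip _<_) βs × All (_∈ M′) βs × length βs ≡ length αs
    crossing⇒nesting {[]} _ _ = [] , fan [] [] (λ ()) , [] , refl
    crossing⇒nesting {_ ∷ _} f αs∈
      with Nestings.fan-attained sweep₂
             (∈-map⁺ _ᵗ (Crossings.fan-cell sweep₁ f (All.map (arcs₁≐ .⇐) αs∈) refl))
    ... | βs , g , βs∈ , len = βs , g , All.map (arcs₂≐ .⇒) βs∈ , len

    nesting⇒crossing : ∀ {αs} → IsFan (flip _<_) αs → All (_∈ M) αs →
                       ∃[ βs ] IsFan _<_ βs × All (_∈ M′) βs × length βs ≡ length αs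
    nesting⇒crossing {[]} _ _ = [] , fan [] [] (λ ()) , [] , refl
    nesting⇒crossing {_ ∷ _} f αs∈
      with Crossings.fan-attained sweep₂
             (∈-map⁺ _ᵗ (Nestings.fan-cell sweep₁ f (All.map (arcs₁≐ .⇐) αs∈) refl))
    ... | βs , g , βs∈ , len = βs , g , All.map (arcs₂≐ .⇒) βs∈ , len

  -- Events and arcs are listed in increasing order, and as sets both are determined by the
  -- matching.
  sweeps-agree : ∀ {es es′ B B′ cs cs′ M} → Sweep es B [] [] cs → Sweep es′ B′ [] [] cs′ →
                 B ≐ M → B′ ≐ M → es ≡ es′ × B ≡ B′
  sweeps-agree s s′ e e′ =
    sorted-unique asym (events-sorted s) (events-sorted s′) (events⊆ s s′ (≐-trans e (≐-sym e′)))
      (events⊆ s′ s (≐-trans e′ (≐-sym e))) ,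
    sorted-unique asym (arcs-sorted s) (arcs-sorted s′) (e′ .⇐ ∘ e .⇒) (e .⇐ ∘ e′ .⇒)
    where
    events⊆ : ∀ {es es′ B B′ cs cs′} → Sweep es B [] [] cs → Sweep es′ B′ [] [] cs′ →
              B ≐ B′ → ∀ {z} → z ∈ es → z ∈ es′
    events⊆ s s′ e {closer y} y∈ = closer∈ s′ (e .⇒ (proj₂ (∈closer s y∈)))
    events⊆ s s′ e {opener x} x∈ with opener∈ s′ (e .⇒ (proj₂ (∈opener s x∈)))
    ... | inj₁ x∈′ = x∈′

  conjugate-unique : ∀ {M M′ M″} → Conjugate M M′ → Conjugate M M″ → M′ ≐ M″
  conjugate-unique c d
    with sweeps-agree (Conjugate.sweep₁ c) (Conjugate.sweep₁ d) (Conjugate.arcs₁≐ c) (Conjugate.arcs₁≐ d)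
  ... | refl , refl with sweep-functional (Conjugate.sweep₁ c) (Conjugate.sweep₁ d)
  ...   | _ , refl with sweep-injective (Conjugate.sweep₂ c) (Conjugate.sweep₂ d)
  ...     | eq = ≐-trans (≐-sym (Conjugate.arcs₂≐ c))
                   (subst (_≐ _) (sym eq) (Conjugate.arcs₂≐ d))

-- Lists: pairwise relations, pointwise choice and entries at equal positions

module _ {A : Set} where

  AllPairs-∈ : ∀ {R S : Rel A 0ℓ} {xs} → (∀ {x y} → x ∈ xs → y ∈ xs → R x y → S x y) →
               AllPairs R xs → AllPairs S xs
  AllPairs-∈ f []       = []
  AllPairs-∈ f (r ∷ rs) =
    All.tabulate (λ y∈ → f (here refl) (there y∈) (All.lookup r y∈))
    ∷ AllPairs-∈ (λ x∈ y∈ → f (there x∈) (there y∈)) rs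

  AllPairs-lookup : ∀ {R : Rel A 0ℓ} {xs x y} → AllPairs R xs → x ∈ xs → y ∈ xs →
                    x ≡ y ⊎ R x y ⊎ R y x
  AllPairs-lookup (r ∷ rs) (here refl) (here refl) = inj₁ refl
  AllPairs-lookup (r ∷ rs) (here refl) (there y∈)  = inj₂ (inj₁ (All.lookup r y∈))
  AllPairs-lookup (r ∷ rs) (there x∈)  (here refl) = inj₂ (inj₂ (All.lookup r x∈))
  AllPairs-lookup (r ∷ rs) (there x∈)  (there y∈)  = AllPairs-lookup rs x∈ y∈

  AllPairs-reverse : ∀ {R : Rel A 0ℓ} {xs} → AllPairs R xs → AllPairs (flip R) (reverse xs)
  AllPairs-reverse = go [] (All.tabulate λ _ → [])
    where
    go : ∀ {R : Rel A 0ℓ} {acc xs} → AllPairs (flip R) acc → All (λ x → All (flip R x) acc) xs →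
         AllPairs R xs → AllPairs (flip R) (xs ʳ++ acc)
    go as _        []       = as
    go as (p ∷ ps) (r ∷ rs) = go (p ∷ as) (All.zipWith (λ (s , q) → s ∷ q) (r , ps)) rs

  ++-AllPairs⁻ : ∀ {R : Rel A 0ℓ} xs {ys} → AllPairs R (xs ++ ys) →
                 AllPairs R xs × AllPairs R ys × All (λ x → All (R x) ys) xs
  ++-AllPairs⁻ []       rs       = [] , rs , []
  ++-AllPairs⁻ (x ∷ xs) (r ∷ rs) with ++-AllPairs⁻ xs rs
  ... | as , bs , cs = All.++⁻ˡ xs r ∷ as , bs , All.++⁻ʳ xs r ∷ cs

  Pointwise-∈ˡ : ∀ {R : Rel A 0ℓ} {xs ys x} → Pointwise R xs ys → x ∈ xs → ∃[ y ] y ∈ ys × R x y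
  Pointwise-∈ˡ (r ∷ _)  (here refl) = _ , here refl , r
  Pointwise-∈ˡ (_ ∷ rs) (there x∈) with Pointwise-∈ˡ rs x∈
  ... | y , y∈ , r = y , there y∈ , r

  Pointwise-∈ʳ : ∀ {R : Rel A 0ℓ} {xs ys y} → Pointwise R xs ys → y ∈ ys → ∃[ x ] x ∈ xs × R x y
  Pointwise-∈ʳ (r ∷ _)  (here refl) = _ , here refl , r
  Pointwise-∈ʳ (_ ∷ rs) (there y∈) with Pointwise-∈ʳ rs y∈
  ... | x , x∈ , r = x , there x∈ , r

choose : ∀ {A B : Set} {R : A → B → Set} xs → (∀ {x} → x ∈ xs → ∃[ y ] R x y) →
         ∃[ ys ] Pointwise R xs ys
choose []       f = [] , []
choose (x ∷ xs) f with f (here refl) | choose xs (f ∘ there)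
... | y , r | ys , rs = y ∷ ys , r ∷ rs

data Paired {A B : Set} : List A → List B → A → B → Set where
  here  : ∀ {x y xs ys} → Paired (x ∷ xs) (y ∷ ys) x y
  there : ∀ {x y x′ y′ xs ys} → Paired xs ys x y → Paired (x′ ∷ xs) (y′ ∷ ys) x y

module _ {A B : Set} where
  private
    variable
      x x′ : A
      y y′ : B
      xs : List A
      ys ys′ : List B

  ∈-zipWith⁻ : ∀ {C : Set} (f : A → B → C) xs ys {z} → z ∈ zipWith f xs ys →
               ∃[ x ] ∃[ y ] Paired xs ys x y × z ≡ f x y
  ∈-zipWith⁻ f (x ∷ xs) (y ∷ ys) (here eq) = x , y , here , eq
  ∈-zipWith⁻ f (x ∷ xs) (y ∷ ys) (there z∈) with ∈-zipWith⁻ f xs ys z∈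
  ... | x′ , y′ , p , eq = x′ , y′ , there p , eq

  ∈-zipWith⁺ : ∀ {C : Set} (f : A → B → C) → Paired xs ys x y → f x y ∈ zipWith f xs ys
  ∈-zipWith⁺ f here      = here refl
  ∈-zipWith⁺ f (there p) = there (∈-zipWith⁺ f p)

  paired-∈ˡ : Paired xs ys x y → x ∈ xs
  paired-∈ˡ here      = here refl
  paired-∈ˡ (there p) = there (paired-∈ˡ p)

  paired-∈ʳ : Paired xs ys x y → y ∈ ys
  paired-∈ʳ here      = here refl
  paired-∈ʳ (there p) = there (paired-∈ʳ p)

  pairˡ : length xs ≡ length ys → x ∈ xs → ∃[ y ] Paired xs ys x y
  pairˡ {xs = _ ∷ _} {_ ∷ _} eq (here refl) = _ , here
  pairˡ {xs = _ ∷ _} {_ ∷ _} eq (there x∈) with pairˡ (ℕ.suc-injective eq) x∈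
  ... | y , p = y , there p

  pairʳ : length xs ≡ length ys → y ∈ ys → ∃[ x ] Paired xs ys x y
  pairʳ {xs = _ ∷ _} {_ ∷ _} eq (here refl) = _ , here
  pairʳ {xs = _ ∷ _} {_ ∷ _} eq (there y∈) with pairʳ (ℕ.suc-injective eq) y∈
  ... | x , p = x , there p

  paired-functional : Unique xs → Paired xs ys x y → Paired xs ys x y′ → y ≡ y′
  paired-functional u        here      here      = refl
  paired-functional (n ∷ _)  here      (there q) = contradiction refl (All.lookup n (paired-∈ˡ q))
  paired-functional (n ∷ _)  (there p) here      = contradiction refl (All.lookup n (paired-∈ˡ p))
  paired-functional (_ ∷ u)  (there p) (there q) = paired-functional u p q

  paired-injective : Unique ys → Paired xs ys x y → Paired xs ys x′ y → x ≡ x′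
  paired-injective u        here      here      = refl
  paired-injective (n ∷ _)  here      (there q) = contradiction refl (All.lookup n (paired-∈ʳ q))
  paired-injective (n ∷ _)  (there p) here      = contradiction refl (All.lookup n (paired-∈ʳ p))
  paired-injective (_ ∷ u)  (there p) (there q) = paired-injective u p q

  paired-unique : length xs ≡ length ys → Unique xs →
                  (∀ {x x′ y} → Paired xs ys x y → Paired xs ys x′ y → x ≡ x′) → Unique ys
  paired-unique {[]}    {[]}    _  []      f = []
  paired-unique {_ ∷ _} {_ ∷ _} eq (n ∷ u) f =
    All.tabulate (λ { y∈ refl → distinct (pairʳ (ℕ.suc-injective eq) y∈) })
    ∷ paired-unique (ℕ.suc-injective eq) u (λ p q → f (there p) (there q))
    where
    distinct : ¬ (∃[ x ] Paired _ _ x _)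
    distinct (x , p) = All.lookup n (paired-∈ˡ p) (f here (there p))

  paired-≡ : length xs ≡ length ys → length xs ≡ length ys′ →
             (∀ {x y y′} → Paired xs ys x y → Paired xs ys′ x y′ → y ≡ y′) → ys ≡ ys′
  paired-≡ {[]}    {[]}    {[]}    _  _   f = refl
  paired-≡ {_ ∷ _} {_ ∷ _} {_ ∷ _} eq eq′ f = cong₂ _∷_ (f here here)
    (paired-≡ (ℕ.suc-injective eq) (ℕ.suc-injective eq′) (λ p q → f (there p) (there q)))

  pointwise-paired : ∀ {R : A → B → Set} → Pointwise R xs ys → Paired xs ys x y → R x y
  pointwise-paired (r ∷ _)  here      = r
  pointwise-paired (_ ∷ rs) (there p) = pointwise-paired rs p

-- Linked cycles as matchings

<ᵥ-isStrictTotalOrder : ∀ {n} → IsStrictTotalOrder _≡_ (_<ᵥ_ {n})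
<ᵥ-isStrictTotalOrder = record
  { isStrictPartialOrder = record
    { isEquivalence = isEquivalence
    ; irrefl        = λ { refl (inj₁ p) → Fin.<-irrefl refl p ; refl (inj₂ (_ , p)) → ℕ.<-irrefl refl p }
    ; trans         = λ { (inj₁ p) (inj₁ q) → inj₁ (Fin.<-trans p q)
                        ; (inj₁ p) (inj₂ (refl , _)) → inj₁ p
                        ; (inj₂ (refl , _)) (inj₁ q) → inj₁ q
                        ; (inj₂ (refl , p)) (inj₂ (refl , q)) → inj₂ (refl , ℕ.<-trans p q) }
    ; <-resp-≈      = (λ { refl p → p }) , (λ { refl p → p })
    }
  ; compare = λ u v → convert (×-compare sym Fin.<-cmp ℕ.<-cmp u v)
  }
  where
  convert : ∀ {n} {u v : Vertex n} → Tri (u <ᵥ v) (proj₁ u ≡ proj₁ v × proj₂ u ≡ proj₂ v) (v <ᵥ u) →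
            Tri (u <ᵥ v) (u ≡ v) (v <ᵥ u)
  convert (tri< p q r) = tri< p (λ { refl → q (refl , refl) }) r
  convert (tri≈ p (refl , refl) r) = tri≈ p refl r
  convert (tri> p q r) = tri> p (λ { refl → q (refl , refl) }) r

module Cycles {n : ℕ} where
  open Sweeps (<ᵥ-isStrictTotalOrder {n}) using
    (IsMatching; Conjugate; _≐_; ⇒; ⇐; ≐-intro; ≐-sym; IsFan; fan; conjugate-exists; conjugate-sym;
     conjugate-resp; conjugate-unique; conjugate-matching; conjugate-opener; conjugate-closer;
     crossing⇒nesting; nesting⇒crossing)

  tail⁺ : Cycle n → List (Fin n)
  tail⁺ = List⁺.tail

  slots : Cycle n → List ℕ
  slots c = map suc (upTo (length (tail⁺ c)))

  length-slots : ∀ c → length (slots c) ≡ length (reverse (tail⁺ c))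
  length-slots (i List⁺.∷ is) = trans (length-map suc (upTo (length is)))
    (trans (length-upTo (length is)) (sym (length-reverse is)))

  slots-unique : ∀ c → Unique (slots c)
  slots-unique c = Unique.map⁺ ℕ.suc-injective (Unique.upTo⁺ _)

  Slot : Cycle n → ℕ → Fin n → Set
  Slot c = Paired (slots c) (reverse (tail⁺ c))

  arc : Cycle n → ℕ → Fin n → Arc n
  arc c j i = (minimum c , j) , (i , 0)

  ∈-arcs⁺ : ∀ {π c j i} → c ∈ π → Slot c j i → arc c j i ∈ arcs π
  ∈-arcs⁺ c∈ p = ∈-concatMap⁺ cycleArcs (Any.map (λ { refl → ∈-zipWith⁺ _ p }) c∈)

  record ArcOf (π : List (Cycle n)) (α : Arc n) : Set where
    constructor arcOf
    field
      {cycle} : Cycle n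
      {index} : ℕ
      {target} : Fin n
      cycle∈  : cycle ∈ π
      slot    : Slot cycle index target
      arc≡    : α ≡ arc cycle index target

  ∈-arcs⁻ : ∀ π {α} → α ∈ arcs π → ArcOf π α
  ∈-arcs⁻ π α∈ with find (∈-concatMap⁻ cycleArcs {xs = π} α∈)
  ... | c , c∈ , α∈c with ∈-zipWith⁻ _ (slots c) (reverse (tail⁺ c)) α∈c
  ...   | j , i , p , eq = arcOf c∈ p eq

  slot-tail : ∀ c {j i} → Slot c j i → i ∈ tail⁺ c
  slot-tail c p = Perm.∈-resp-↭ (Perm.↭-reverse (tail⁺ c)) (paired-∈ʳ p)

  tail-slot : ∀ c {i} → i ∈ tail⁺ c → ∃[ j ] Slot c j i
  tail-slot c i∈ = pairʳ (length-slots c) (Perm.∈-resp-↭ (↭-sym (Perm.↭-reverse (tail⁺ c))) i∈)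

  slot-suc : ∀ c {j i} → Slot c j i → ∃[ k ] j ≡ suc k
  slot-suc c p with ∈-map⁻ suc (paired-∈ˡ p)
  ... | k , _ , eq = k , eq

  InTail : List (Cycle n) → Fin n → Set
  InTail π i = ∃[ c ] c ∈ π × i ∈ tail⁺ c

  module LinkedCycle {π : List (Cycle n)} (lc : IsLinkedCycle π) where
    open IsLinkedCycle lc

    minimum-injective : ∀ {c d} → c ∈ π → d ∈ π → minimum c ≡ minimum d → c ≡ d
    minimum-injective c∈ d∈ eq with AllPairs-lookup sorted c∈ d∈
    ... | inj₁ c≡d        = c≡d
    ... | inj₂ (inj₁ c<d) = contradiction c<d (Fin.<-irrefl eq)
    ... | inj₂ (inj₂ d<c) = contradiction d<c (Fin.<-irrefl (sym eq))

    tail-> : ∀ {c i} → c ∈ π → i ∈ tail⁺ c → minimum c Fin.< i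
    tail-> c∈ i∈ = All.lookup (IsCycle.minimal (All.lookup cycles c∈)) i∈

    -- A common element of two distinct blocks is the minimum of one of them, and a tail element is
    -- not.
    tail-injective : ∀ {c d i} → c ∈ π → d ∈ π → i ∈ tail⁺ c → i ∈ tail⁺ d → c ≡ d
    tail-injective c∈ d∈ i∈c i∈d with AllPairs-lookup nearlyDisjoint c∈ d∈
    ... | inj₁ c≡d = c≡d
    ... | inj₂ (inj₁ nd) with nd _ (there i∈c) (there i∈d)
    ...   | inj₁ (eq , _) = contradiction (tail-> c∈ i∈c) (Fin.<-irrefl (sym eq))
    ...   | inj₂ (eq , _) = contradiction (tail-> d∈ i∈d) (Fin.<-irrefl (sym eq))
    tail-injective c∈ d∈ i∈c i∈d | inj₂ (inj₂ nd) with nd _ (there i∈d) (there i∈c)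
    ...   | inj₁ (eq , _) = contradiction (tail-> d∈ i∈d) (Fin.<-irrefl (sym eq))
    ...   | inj₂ (eq , _) = contradiction (tail-> c∈ i∈c) (Fin.<-irrefl (sym eq))

    tail-unique : ∀ {c} → c ∈ π → Unique (reverse (tail⁺ c))
    tail-unique {i List⁺.∷ is} c∈ with IsCycle.distinct (All.lookup cycles c∈)
    ... | _ ∷ u = PermSetoid.Unique-resp-↭ (setoid _) (↭⇒↭ₛ (↭-sym (Perm.↭-reverse is))) u

    -- A minimum determines its cycle and a tail element lies in only one tail. Openers have
    -- positive superscripts while closers have superscript 0, so no vertex is both.
    arcs-matching : IsMatching (arcs π)
    arcs-matching = record
      { increasing = increasing ; functional = functional ; injective = injective ; disjoint = disjoint }
      where
      increasing : ∀ {x y} → (x , y) ∈ arcs π → x <ᵥ y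
      increasing α∈ with ∈-arcs⁻ π α∈
      ... | arcOf {c} c∈ p refl = inj₁ (tail-> c∈ (slot-tail c p))

      functional : ∀ {x y z} → (x , z) ∈ arcs π → (y , z) ∈ arcs π → x ≡ y
      functional α∈ β∈ with ∈-arcs⁻ π α∈ | ∈-arcs⁻ π β∈
      ... | arcOf {c} c∈ p refl | arcOf {d} d∈ q refl
        with refl ← tail-injective c∈ d∈ (slot-tail c p) (slot-tail d q) =
        cong (minimum c ,_) (paired-injective (tail-unique c∈) p q)

      injective : ∀ {x y z} → (x , y) ∈ arcs π → (x , z) ∈ arcs π → y ≡ z
      injective α∈ β∈ with ∈-arcs⁻ π α∈ | ∈-arcs⁻ π β∈
      ... | arcOf {c} c∈ p refl | arcOf {d} d∈ q eq
        with refl ← minimum-injective c∈ d∈ (cong (proj₁ ∘ proj₁) eq)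
           | refl ← cong (proj₂ ∘ proj₁) eq
        with refl ← paired-functional (slots-unique c) p q = sym (cong proj₂ eq)

      disjoint : ∀ {x y z} → (x , y) ∈ arcs π → ¬ (y , z) ∈ arcs π
      disjoint α∈ β∈ with ∈-arcs⁻ π α∈ | ∈-arcs⁻ π β∈
      ... | arcOf {c} c∈ p refl | arcOf {d} d∈ q eq with slot-suc d q
      ...   | k , refl = contradiction (cong (proj₂ ∘ proj₁) eq) λ ()

  -- Cycle shapes, labellings and transfer of the linked-cycle conditions

  record SameShape (c d : Cycle n) : Set where
    constructor sameShape
    field
      minimum≡ : minimum c ≡ minimum d
      length≡  : length (tail⁺ c) ≡ length (tail⁺ d)
  open SameShape

  sameShape-sym : ∀ {c d} → SameShape c d → SameShape d c
  sameShape-sym (sameShape p q) = sameShape (sym p) (sym q)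

  SameShapes : List (Cycle n) → List (Cycle n) → Set
  SameShapes = Pointwise SameShape

  slots-cong : ∀ {c d} → SameShape c d → slots c ≡ slots d
  slots-cong s = cong (map suc ∘ upTo) (length≡ s)

  openings-cong : ∀ {π π′} → SameShapes π π′ → ∀ i → openings π i ≡ openings π′ i
  openings-cong []                                    i = refl
  openings-cong {c ∷ _} {d ∷ _} (sameShape eq eq′ ∷ ss) i with i Fin.≟ minimum c | i Fin.≟ minimum d
  ... | yes _ | yes _ = cong₂ _∷_ eq′ (openings-cong ss i)
  ... | yes p | no ¬q = contradiction (trans p eq) ¬q
  ... | no ¬p | yes q = contradiction (trans q (sym eq)) ¬p
  ... | no _  | no _  = openings-cong ss i

  private
    AtMostOne : Pred (Cycle n) 0ℓ → List (Cycle n) → Set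
    AtMostOne P = AllPairs (λ c d → P c → ¬ P d)

    count-one : ∀ {P : Pred (Cycle n) 0ℓ} (P? : Decidable P) {xs} → AtMostOne P xs → Any P xs →
                length (filter P? xs) ≡ 1
    count-one P? {x ∷ xs} (n ∷ ns) (here p) = trans (cong length (filter-accept P? p))
      (cong (suc ∘ length) (filter-none P? (All.map (λ f → f p) n)))
    count-one P? {x ∷ xs} (n ∷ ns) (there a) = trans
      (cong length (filter-reject P? (λ p → All.lookupWith (λ f q → f p q) n a)))
      (count-one P? ns a)

    count-cong : ∀ {P : Pred (Cycle n) 0ℓ} (P? : Decidable P) {xs ys} → AtMostOne P xs → AtMostOne P ys →
                 (Any P xs → Any P ys) → (Any P ys → Any P xs) →
                 length (filter P? xs) ≡ length (filter P? ys)
    count-cong P? {xs} {ys} ax ay f g with Any.any? P? xs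
    ... | yes a = trans (count-one P? ax a) (sym (count-one P? ay (f a)))
    ... | no ¬a = trans (cong length (filter-none P? (All.¬Any⇒All¬ xs ¬a)))
                        (sym (cong length (filter-none P? (All.¬Any⇒All¬ ys (¬a ∘ g)))))

    inTail? : ∀ i → Decidable (λ (c : Cycle n) → i ∈ tail⁺ c)
    inTail? i c = Any.any? (i Fin.≟_) (tail⁺ c)

    coverage-split : ∀ π i → All IsCycle π →
      coverage π i ≡ length (openings π i) ℕ.+ length (filter (inTail? i) π)
    coverage-split []      i []       = refl
    coverage-split (c ∷ π) i (p ∷ ps) with i ∈ᶜ? c | i Fin.≟ minimum c | inTail? i c
    ... | yes _         | yes refl | yes i∈ = contradiction (All.lookup (IsCycle.minimal p) i∈) (Fin.<-irrefl refl)
    ... | yes _         | yes _    | no _   = cong suc (coverage-split π i ps)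
    ... | yes _         | no _     | yes _  = trans (cong suc (coverage-split π i ps)) (sym (ℕ.+-suc _ _))
    ... | yes (here eq) | no ¬eq   | no _   = contradiction eq ¬eq
    ... | yes (there i∈) | no _    | no i∉  = contradiction i∈ i∉
    ... | no i∉         | yes eq   | _      = contradiction (here eq) i∉
    ... | no i∉         | no _     | yes i∈ = contradiction (there i∈) i∉
    ... | no _          | no _     | no _   = coverage-split π i ps

  InTail⇒Any : ∀ {π i} → InTail π i → Any (λ c → i ∈ tail⁺ c) π
  InTail⇒Any (c , c∈ , i∈) = Any.map (λ { refl → i∈ }) c∈

  Any⇒InTail : ∀ {π i} → Any (λ c → i ∈ tail⁺ c) π → InTail π i
  Any⇒InTail = find

  tail-AtMostOne : ∀ {π} → IsLinkedCycle π → ∀ i → AtMostOne (λ c → i ∈ tail⁺ c) π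
  tail-AtMostOne lc i = AllPairs-∈
    (λ { c∈ d∈ c<d i∈c i∈d → Fin.<-irrefl (cong minimum (tail-injective c∈ d∈ i∈c i∈d)) c<d }) sorted
    where
    open LinkedCycle lc
    open IsLinkedCycle lc

  -- By `coverage-split`, the superscripts at `i` depend only on the sizes of the cycles with
  -- minimum `i` and on whether `i` lies in a tail, which happens at most once.
  labelling-cong : ∀ {π π′} → IsLinkedCycle π → IsLinkedCycle π′ → SameShapes π π′ →
                   (∀ {i} → InTail π i → InTail π′ i) → (∀ {i} → InTail π′ i → InTail π i) →
                   labelling π ≡ labelling π′
  labelling-cong {π} {π′} lc lc′ ss f g = concatMap-cong
    (λ i → cong (map (i ,_)) (cong₂ superscripts (coverage-cong i) (openings-cong ss i))) (allFin n)
    where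
    coverage-cong : ∀ i → coverage π i ≡ coverage π′ i
    coverage-cong i = trans (coverage-split π i (IsLinkedCycle.cycles lc))
      (trans (cong₂ ℕ._+_ (cong length (openings-cong ss i))
        (count-cong (inTail? i) (tail-AtMostOne lc i) (tail-AtMostOne lc′ i)
          (InTail⇒Any ∘ f ∘ Any⇒InTail) (InTail⇒Any ∘ g ∘ Any⇒InTail)))
      (sym (coverage-split π′ i (IsLinkedCycle.cycles lc′))))

  module _ {π π′ : List (Cycle n)} (lc : IsLinkedCycle π) (ss : SameShapes π π′)
    (m : IsMatching (arcs π′)) (f : ∀ {i} → InTail π i → InTail π′ i)
    (g : ∀ {i} → InTail π′ i → InTail π i) where

    open LinkedCycle lc
    open IsLinkedCycle lc
    open IsMatching m

    private
      minima : map minimum π ≡ map minimum π′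
      minima = Pointwise.Pointwise-≡⇒≡ (Pointwise.map⁺ minimum minimum (Pointwise.map minimum≡ ss))

      sorted′ : AllPairs (λ c d → minimum c Fin.< minimum d) π′
      sorted′ = AllPairs.map⁻ (subst (AllPairs Fin._<_) minima (AllPairs.map⁺ sorted))

      minimal′ : ∀ {c i} → c ∈ π′ → i ∈ tail⁺ c → minimum c Fin.< i
      minimal′ {c} c∈ i∈ with tail-slot c i∈
      ... | j , p with increasing (∈-arcs⁺ c∈ p)
      ...   | inj₁ c<i = c<i

      cycle′ : ∀ {c} → c ∈ π′ → IsCycle c
      cycle′ {c} c∈ = mkIsCycle (All.tabulate (minimal′ c∈))
        (All.tabulate (λ i∈ eq → Fin.<-irrefl eq (minimal′ c∈ i∈)) ∷
         PermSetoid.Unique-resp-↭ (setoid _) (↭⇒↭ₛ (Perm.↭-reverse (tail⁺ c)))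
           (paired-unique (length-slots c) (slots-unique c)
             (λ p q → cong proj₂ (functional (∈-arcs⁺ c∈ p) (∈-arcs⁺ c∈ q)))))

      tail-minimum : ∀ {c d i} → c ∈ π′ → d ∈ π′ → i ∈ tail⁺ c → i ∈ tail⁺ d → minimum c ≡ minimum d
      tail-minimum {c} {d} c∈ d∈ i∈c i∈d with tail-slot c i∈c | tail-slot d i∈d
      ... | _ , p | _ , q = cong proj₁ (functional (∈-arcs⁺ c∈ p) (∈-arcs⁺ d∈ q))

      -- Sizes are preserved, so the corresponding block `c₀` of `π` may be considered; its minimum
      -- also lies in the tail of another block, and near-disjointness then gives it a second
      -- element.
      nontrivial : ∀ {c} → c ∈ π′ → InTail π′ (minimum c) → List⁺.length c ℕ.> 1
      nontrivial {c} c∈ t with Pointwise-∈ʳ ss c∈ | g t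
      ... | c₀ , c₀∈ , s | e , e∈ , i∈ = subst (λ l → suc l ℕ.> 1) (length≡ s)
          (large (AllPairs-lookup nearlyDisjoint c₀∈ e∈))
        where
        i≢ : minimum c ≢ minimum e
        i≢ eq = Fin.<-irrefl (sym eq) (tail-> e∈ i∈)

        large : c₀ ≡ e ⊎ NearlyDisjoint c₀ e ⊎ NearlyDisjoint e c₀ → List⁺.length c₀ ℕ.> 1
        large (inj₁ refl) = contradiction (sym (minimum≡ s)) i≢
        large (inj₂ (inj₁ nd)) with nd _ (here (sym (minimum≡ s))) (there i∈)
        ... | inj₁ (_ , l , _)  = l
        ... | inj₂ (eq , _ , _) = contradiction eq i≢
        large (inj₂ (inj₂ nd)) with nd _ (there i∈) (here (sym (minimum≡ s)))
        ... | inj₁ (eq , _ , _) = contradiction eq i≢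
        ... | inj₂ (_ , l , _)  = l

      nearlyDisjoint′ : ∀ {c d} → c ∈ π′ → d ∈ π′ → minimum c Fin.< minimum d → NearlyDisjoint c d
      nearlyDisjoint′ c∈ d∈ c<d i (here refl) (here eq)   = contradiction c<d (Fin.<-irrefl eq)
      nearlyDisjoint′ c∈ d∈ c<d i (here refl) (there i∈d) =
        inj₁ (refl , nontrivial c∈ (_ , d∈ , i∈d) , λ eq → Fin.<-irrefl (sym eq) (minimal′ d∈ i∈d))
      nearlyDisjoint′ c∈ d∈ c<d i (there i∈c) (here refl) =
        inj₂ (refl , nontrivial d∈ (_ , c∈ , i∈c) , λ eq → Fin.<-irrefl (sym eq) (minimal′ c∈ i∈c))
      nearlyDisjoint′ c∈ d∈ c<d i (there i∈c) (there i∈d) =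
        contradiction c<d (Fin.<-irrefl (tail-minimum c∈ d∈ i∈c i∈d))

      covering′ : ∀ i → Any (i ∈ᶜ_) π′
      covering′ i with find (covering i)
      ... | c , c∈ , there i∈ with f (c , c∈ , i∈)
      ...   | d , d∈ , i∈d = Any.map (λ { refl → there i∈d }) d∈
      covering′ i | c , c∈ , here refl with Pointwise-∈ˡ ss c∈
      ... | d , d∈ , s = Any.map (λ { refl → here (minimum≡ s) }) d∈

    linkedCycle-transfer : IsLinkedCycle π′
    linkedCycle-transfer = mkIsLinkedCycle (All.tabulate cycle′) sorted′
      (AllPairs-∈ nearlyDisjoint′ sorted′) covering′

  -- Minima and sizes fix the openers, and the closer matched to each opener is the tail entry at
  -- the corresponding place.
  arcs-injective : ∀ {π₁ π₂} → IsMatching (arcs π₁) → SameShapes π₁ π₂ → arcs π₁ ≐ arcs π₂ → π₁ ≡ π₂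
  arcs-injective {π₁} {π₂} m ss e = go ss id id
    where
    cycle≡ : ∀ {c d} → c ∈ π₁ → d ∈ π₂ → SameShape c d → c ≡ d
    cycle≡ {c} {d} c∈ d∈ s@(sameShape refl len) = cong (minimum c List⁺.∷_) (reverse-injective
      (paired-≡ (length-slots c) (trans (cong length (slots-cong s)) (length-slots d))
        (λ p q → cong proj₁ (IsMatching.injective m (∈-arcs⁺ c∈ p)
          (e .⇐ (∈-arcs⁺ d∈ (subst (λ js → Paired js _ _ _) (slots-cong s) q)))))))

    go : ∀ {cs ds} → SameShapes cs ds → (∀ {c} → c ∈ cs → c ∈ π₁) → (∀ {d} → d ∈ ds → d ∈ π₂) → cs ≡ ds
    go []       f g = refl
    go (s ∷ ss) f g = cong₂ _∷_ (cycle≡ (f (here refl)) (g (here refl)) s) (go ss (f ∘ there) (g ∘ there))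

  -- Conjugate linked cycles

  record ConjugateCycles (π π′ : List (Cycle n)) : Set where
    constructor conjugateCycles
    field
      shapes    : SameShapes π π′
      conjugate : Conjugate (arcs π) (arcs π′)
  open ConjugateCycles

  conjugateCycles-sym : ∀ {π π′} → ConjugateCycles π π′ → ConjugateCycles π′ π
  conjugateCycles-sym (conjugateCycles ss c) =
    conjugateCycles (Pointwise.symmetric sameShape-sym ss) (conjugate-sym c)

  conjugateCycles-unique : ∀ {π π₁ π₂} → ConjugateCycles π π₁ → ConjugateCycles π π₂ → π₁ ≡ π₂
  conjugateCycles-unique (conjugateCycles ss c) (conjugateCycles ss′ c′) =
    arcs-injective (conjugate-matching c)
      (Pointwise.transitive trans-shape (Pointwise.symmetric sameShape-sym ss) ss′)
      (conjugate-unique c c′)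
    where
    trans-shape : ∀ {c d e} → SameShape c d → SameShape d e → SameShape c e
    trans-shape (sameShape p q) (sameShape p′ q′) = sameShape (trans p p′) (trans q q′)

  inTail-conjugate : ∀ {π π′} → Conjugate (arcs π) (arcs π′) → ∀ {i} → InTail π i → InTail π′ i
  inTail-conjugate {π} {π′} cj (c , c∈ , i∈) with tail-slot c i∈
  ... | j , p with conjugate-closer cj (∈-arcs⁺ c∈ p)
  ...   | _ , β∈ with ∈-arcs⁻ π′ β∈
  ...     | arcOf {d} d∈ q eq = d , d∈ , subst (_∈ tail⁺ d) (sym (cong (proj₁ ∘ proj₂) eq)) (slot-tail d q)

  module _ {π : List (Cycle n)} {M : List (Arc n)} (lc : IsLinkedCycle π) (cj : Conjugate (arcs π) M) where

    private
      Rebuilt : Cycle n → Cycle n → Set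
      Rebuilt c d = SameShape c d × (∀ {j i} → Slot d j i → arc d j i ∈ M)

      target : ∀ {c} → c ∈ π → ∀ {j} → j ∈ slots c → ∃[ i ] arc c j i ∈ M
      target {c} c∈ {j} j∈ with pairˡ (length-slots c) j∈
      ... | _ , p with conjugate-opener cj (∈-arcs⁺ c∈ p)
      -- The closer is traced back to `π` to learn that its superscript is 0, so that it can serve
      -- as a tail element.
      ...   | y , β∈ with conjugate-closer (conjugate-sym cj) β∈
      ...     | x , α∈ with ∈-arcs⁻ π α∈
      ...       | arcOf {target = i} _ _ refl = i , β∈

      -- Slots run through a tail backwards, so the chosen closers are reversed.
      withTail : ∀ c is → Pointwise (λ j i → arc c j i ∈ M) (slots c) is →
                 Rebuilt c (minimum c List⁺.∷ reverse is)
      withTail c is ps = shape , λ p → pointwise-paired ps (unreverse p)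
        where
        len : length (reverse is) ≡ length (tail⁺ c)
        len = trans (length-reverse is) (trans (sym (Pointwise.Pointwise-length ps))
          (trans (length-slots c) (length-reverse (tail⁺ c))))

        shape : SameShape c (minimum c List⁺.∷ reverse is)
        shape = sameShape refl (sym len)

        unreverse : ∀ {j i} → Slot (minimum c List⁺.∷ reverse is) j i → Paired (slots c) is j i
        unreverse {j} {i} = subst id (cong₂ (λ js is → Paired js is j i)
          (sym (slots-cong shape)) (reverse-involutive is))

      rebuild : ∀ {c} → c ∈ π → ∃[ d ] Rebuilt c d
      rebuild {c} c∈ = let is , ps = choose (slots c) (target c∈) in _ , withTail c is ps

    conjugate-linkedCycle : ∃[ π′ ] IsLinkedCycle π′ × labelling π′ ≡ labelling π × ConjugateCycles π π′
    conjugate-linkedCycle = finish (choose π rebuild)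
      where
      finish : ∃[ π′ ] Pointwise Rebuilt π π′ →
               ∃[ π′ ] IsLinkedCycle π′ × labelling π′ ≡ labelling π × ConjugateCycles π π′
      finish (π′ , rs) = π′ , lc′ , sym (labelling-cong lc lc′ ss f g) , conjugateCycles ss cj′
        where
        ss = Pointwise.map proj₁ rs

        sound : ∀ {α} → α ∈ arcs π′ → α ∈ M
        sound α∈ with ∈-arcs⁻ π′ α∈
        ... | arcOf d∈ p refl with Pointwise-∈ʳ rs d∈
        ...   | _ , _ , _ , h = h p

        complete : ∀ {α} → α ∈ M → α ∈ arcs π′
        -- The opener also occurs in `π`, so it belongs to a slot that was filled, and injectivity
        -- of the matching identifies the two closers.
        complete {x , y} α∈ with conjugate-opener (conjugate-sym cj) α∈
        ... | _ , β∈ with ∈-arcs⁻ π β∈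
        ...   | arcOf {c} c∈ p refl with Pointwise-∈ˡ rs c∈
        ...     | d , d∈ , s@(sameShape refl _) , h
          with pairˡ (length-slots d) (subst (_ ∈_) (slots-cong s) (paired-∈ˡ p))
        ...       | i , q with IsMatching.injective (conjugate-matching cj) α∈ (h q)
        ...         | refl = ∈-arcs⁺ d∈ q

        cj′ = conjugate-resp (≐-sym (≐-intro sound complete)) cj
        f : ∀ {i} → InTail π i → InTail π′ i
        f = inTail-conjugate cj′
        g : ∀ {i} → InTail π′ i → InTail π i
        g = inTail-conjugate (conjugate-sym cj′)

        lc′ = linkedCycle-transfer lc ss (conjugate-matching cj′) f g

  conjugateCycles-exists : ∀ {π} → IsLinkedCycle π →
    ∃[ π′ ] IsLinkedCycle π′ × labelling π′ ≡ labelling π × ConjugateCycles π π′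
  conjugateCycles-exists lc = conjugate-linkedCycle lc (proj₂ (conjugate-exists (LinkedCycle.arcs-matching lc)))

  -- Crossings and nestings of linked cycles as fans

  crossing⇒fan : ∀ π {αs} → IsCrossing π αs → IsFan _<ᵥ_ αs
  crossing⇒fan _ {αs} (_ , ord) with ++-AllPairs⁻ (map proj₁ αs) ord
  ... | xs , ys , sep = fan (AllPairs.map⁻ xs) (AllPairs.map⁻ ys)
    (λ α∈ β∈ → All.lookup (All.lookup sep (∈-map⁺ proj₁ α∈)) (∈-map⁺ proj₂ β∈))

  fan⇒crossing : ∀ π {αs} → All (_∈ arcs π) αs → IsFan _<ᵥ_ αs → IsCrossing π αs
  fan⇒crossing _ αs∈ (fan xs ys sep) = αs∈ , AllPairs.++⁺ (AllPairs.map⁺ xs) (AllPairs.map⁺ ys)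
    (All.map⁺ (All.tabulate λ α∈ → All.map⁺ (All.tabulate λ β∈ → sep α∈ β∈)))

  reverse-∈⁻ : ∀ {A : Set} (xs : List A) {x} → x ∈ reverse xs → x ∈ xs
  reverse-∈⁻ xs = Perm.∈-resp-↭ (Perm.↭-reverse xs)

  All-reverse : ∀ {A : Set} {P : Pred A 0ℓ} {xs} → All P xs → All P (reverse xs)
  All-reverse {xs = xs} = Perm.All-resp-↭ (↭-sym (Perm.↭-reverse xs))

  -- Increasing closers in a nesting mean decreasing openers, hence the reversal.
  nesting⇒fan : ∀ π {αs} → IsNesting π αs → IsFan (flip _<ᵥ_) (reverse αs)
  nesting⇒fan _ {αs} (_ , ord) with ++-AllPairs⁻ (map proj₁ αs) ord
  ... | xs , ys , sep = fan (AllPairs-reverse (AllPairs.map⁻ xs))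
    (AllPairs.map⁻ (subst (AllPairs _<ᵥ_) (sym (reverse-map proj₂ αs)) ys))
    (λ α∈ β∈ → All.lookup (All.lookup sep (∈-map⁺ proj₁ (reverse-∈⁻ αs α∈)))
      (Perm.∈-resp-↭ (↭-sym (Perm.↭-reverse (map proj₂ αs))) (∈-map⁺ proj₂ (reverse-∈⁻ αs β∈))))

  fan⇒nesting : ∀ π {αs} → All (_∈ arcs π) αs → IsFan (flip _<ᵥ_) αs → IsNesting π (reverse αs)
  fan⇒nesting _ {αs} αs∈ (fan xs ys sep) =
    All-reverse αs∈ ,
    AllPairs.++⁺ (AllPairs.map⁺ (AllPairs-reverse xs))
      (subst (AllPairs _<ᵥ_) (sym (trans (sym (reverse-map proj₂ (reverse αs)))
        (cong (map proj₂) (reverse-involutive αs)))) (AllPairs.map⁺ ys))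
      (All.map⁺ (All.tabulate λ α∈ → Perm.All-resp-↭ (↭-sym (Perm.↭-reverse (map proj₂ (reverse αs))))
        (All.map⁺ (All.tabulate λ β∈ → sep (reverse-∈⁻ αs α∈) (reverse-∈⁻ αs β∈)))))

  module _ {π π′} (c : ConjugateCycles π π′) where

    cr≤ne : cr π ≤ ne π′
    cr≤ne with cr-attained π
    ... | αs , p , eq with crossing⇒nesting (conjugate c) (crossing⇒fan π p) (proj₁ p)
    ...   | βs , f , βs∈ , len = subst (_≤ ne π′) (trans (length-reverse βs) (trans len eq))
      (ne-upper π′ (fan⇒nesting π′ βs∈ f))

    ne≤cr : ne π ≤ cr π′
    ne≤cr with ne-attained π
    ... | αs , p , eq with nesting⇒crossing (conjugate c) (nesting⇒fan π p) (All-reverse (proj₁ p))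
    ...   | βs , f , βs∈ , len = subst (_≤ cr π′) (trans len (trans (length-reverse αs) eq))
      (cr-upper π′ (fan⇒crossing π′ βs∈ f))

  cr≡ne : ∀ {π π′} → ConjugateCycles π π′ → cr π ≡ ne π′
  cr≡ne c = ℕ.≤-antisym (cr≤ne c) (ne≤cr (conjugateCycles-sym c))

-- Reindexing sums along an involution

module Sums {a ℓ} (R : CommutativeSemiring a ℓ) where
  open Summation R
  open CommutativeSemiring R using (+-cong; +-comm; +-assoc; setoid)
    renaming (refl to ≈-refl; sym to ≈-sym; trans to ≈-trans)

  ∑-cong : ∀ {A : Set} {f g : A → Carrier} {xs ys} → Pointwise (λ x y → f x ≈ g y) xs ys →
           ∑ xs f ≈ ∑ ys g
  ∑-cong []       = ≈-refl
  ∑-cong (e ∷ es) = +-cong e (∑-cong es)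

  ∑-↭ : ∀ {A : Set} {xs ys} (f : A → Carrier) → xs ↭ ys → ∑ xs f ≈ ∑ ys f
  ∑-↭ f _↭_.refl       = ≈-refl
  ∑-↭ f (prep x p)     = +-cong ≈-refl (∑-↭ f p)
  ∑-↭ f (swap x y p)   = ≈-trans (≈-sym (+-assoc _ _ _))
    (≈-trans (+-cong (+-comm _ _) (∑-↭ f p)) (+-assoc _ _ _))
  ∑-↭ f (_↭_.trans p q) = ≈-trans (∑-↭ f p) (∑-↭ f q)

  -- No two elements share a partner, and each element is the partner of its own partner; so the
  -- partners form a list without repetitions that has the same elements as `xs`, a permutation of
  -- it.
  ∑-involution : ∀ {A : Set} {xs} (S : Rel A 0ℓ) {f g : A → Carrier} → Unique xs →
                 (∀ {x} → x ∈ xs → ∃[ y ] y ∈ xs × S x y) →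
                 (∀ {x y} → S x y → S y x) → (∀ {x y z} → S x y → S x z → y ≡ z) →
                 (∀ {x y} → S x y → f x ≈ g y) → ∑ xs f ≈ ∑ xs g
  ∑-involution {A} {xs} S {f} {g} u total S-sym S-functional eq with choose xs total
  ... | ys , ps = ≈-trans (∑-cong (Pointwise.map (eq ∘ proj₂) ps))
    (∑-↭ g (∼bag⇒↭ (unique∧set⇒bag ys! u (mk⇔ ys⊆xs xs⊆ys))))
    where
    ys⊆xs : ∀ {y} → y ∈ ys → y ∈ xs
    ys⊆xs y∈ = proj₁ (proj₂ (proj₂ (Pointwise-∈ʳ ps y∈)))

    xs⊆ys : ∀ {x} → x ∈ xs → x ∈ ys
    xs⊆ys x∈ with total x∈
    ... | y , y∈ , s with Pointwise-∈ˡ ps y∈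
    ...   | z , z∈ , _ , s′ = subst (_∈ ys) (S-functional s′ (S-sym s)) z∈

    ys! : Unique ys
    ys! = go u ps
      where
      go : ∀ {us vs} → Unique us → Pointwise (λ x y → y ∈ xs × S x y) us vs → Unique vs
      go []      []       = []
      go (n ∷ u) ((_ , s) ∷ ss) = All.tabulate (λ { v∈ refl → clash v∈ }) ∷ go u ss
        where
        clash : ¬ _ ∈ _
        clash v∈ with Pointwise-∈ʳ ss v∈
        ... | w , w∈ , _ , s′ = All.lookup n w∈ (S-functional (S-sym s) (S-sym s′))

theorem4p11 : (n : ℕ) → 1 ≤ n → (𝓛 : List (Vertex n)) →
    ∃[ π₀ ] (IsLinkedCycle π₀ × labelling π₀ ≡ 𝓛) →
    {a ℓ : Level} (R : CommutativeSemiring a ℓ) → let open Summation R in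
    (x y : Carrier) →
    ∑ (LC n 𝓛) (λ π → (x ^ cr π) * (y ^ ne π)) ≈ ∑ (LC n 𝓛) (λ π → (x ^ ne π) * (y ^ cr π))
theorem4p11 n _ 𝓛 _ R x y =
  ∑-involution {xs = LC n 𝓛} ConjugateCycles
    {λ π → (x ^ cr π) * (y ^ ne π)} {λ π → (x ^ ne π) * (y ^ cr π)}
    (LC-unique 𝓛) conjugate∈ conjugateCycles-sym conjugateCycles-unique weights
  where
  open Cycles {n}
  open Sums R
  open Summation R
  open CommutativeSemiring R using (reflexive)

  conjugate∈ : ∀ {π} → π ∈ LC n 𝓛 → ∃[ π′ ] π′ ∈ LC n 𝓛 × ConjugateCycles π π′
  conjugate∈ {π} π∈ = result (conjugateCycles-exists (proj₁ lab))
    where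
    lab : HasLabelling 𝓛 π
    lab = ∈-LC⁻ {n} {𝓛} {π} π∈

    result : ∃[ π′ ] IsLinkedCycle π′ × labelling π′ ≡ labelling π × ConjugateCycles π π′ →
             ∃[ π′ ] π′ ∈ LC n 𝓛 × ConjugateCycles π π′
    result (π′ , lc , eq , c) = π′ , ∈-LC⁺ {n} {𝓛} {π′} (lc , trans eq (proj₂ lab)) , c

  weights : ∀ {π π′} → ConjugateCycles π π′ → (x ^ cr π) * (y ^ ne π) ≈ (x ^ ne π′) * (y ^ cr π′)
  weights {π} {π′} c =
    reflexive (cong₂ (λ k l → (x ^ k) * (y ^ l)) (cr≡ne {π = π} {π′} c) (sym (cr≡ne {π = π′} {π} (conjugateCycles-sym c))))
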